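{- Let $n\ge1$, $b$ an integer and $\mathbf k=(k_1,\dots,k_{\lceil n/2\rceil})$ integers with $k_1<\dots<k_{\lceil n/2\rceil}\le b$. The sum of $2^{\#\text{special entries}}$ over all halved monotone triangles of order $n$ with bottom row $\mathbf k$ and no entry larger than $b$ equals $$4^{\binom{(n+1)/2}{2}}\prod_{1\le i<j\le\frac{n+1}{2}}\frac{(k_j-k_i)(2b+1-k_i-k_j)}{(j-i)(i+j-1)}$$ if $n$ is odd, and $$4^{\binom{n/2}{2}}\prod_{1\le i<j\le\frac n2}\frac{(k_j-k_i)(2b+1-k_i-k_j)}{(j-i)(i+j)}\prod_{i=1}^{n/2}\frac{2b+1-2k_i}{i}$$ if $n$ is even.
   Context: A halved monotone triangle of order $n$ is an array of integers $(a_{i,j})$ indexed by $1\le i\le n$, $1\le j\le\lceil i/2\rceil$ (row $i$ from the top has $\lceil i/2\rceil$ entries; row $n$ is the bottom row) such that $a_{i,j}<a_{i,j+1}$ whenever both exist, and for $1\le i<n$: $a_{i+1,j}\le a_{i,j}$, and $a_{i,j}\le a_{i+1,j+1}$ whenever $a_{i+1,j+1}$ exists. Its bottom row is $(a_{n,1},\dots,a_{n,\lceil n/2\rceil})$. An entry $a_{i,j}$ is special if $a_{i+1,j}$ exists and $a_{i+1,j}<a_{i,j}<a_{i+1,j+1}$ in case $a_{i+1,j+1}$ exists, resp. $a_{i+1,j}<a_{i,j}$ otherwise. -}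

module Defs where

open import Data.Nat as ℕ using (ℕ; zero; suc; _∸_; ⌈_/2⌉; _%_)
open import Data.Nat.Combinatorics using (_C_)
open import Data.Integer as ℤ using (ℤ; +_)
open import Data.Rational as ℚ using (ℚ)
open import Data.List as List using (List; []; _∷_; length; concatMap; map; foldr)
open import Data.List.Membership.Propositional using (_∈_)
open import Data.List.Relation.Unary.Unique.Propositional using (Unique)
open import Data.Vec as Vec using (Vec)
open import Data.Maybe using (Maybe; just; nothing; _>>=_)
open import Data.Bool using (Bool; true; false; _∧_; if_then_else_)
open import Data.Product using (Σ; _×_; _,_)
open import Function.Bundles using (_⇔_)
open import Relation.Nullary using (does)
open import Relation.Binary.PropositionalEquality using (_≡_)

_‼_ : {A : Set} → List A → ℕ → Maybe A
[]       ‼ _       = nothing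
(x ∷ xs) ‼ zero    = just x
(x ∷ xs) ‼ suc i   = xs ‼ i

oneTo : ℕ → List ℕ
oneTo m = List.map suc (List.upTo m)

sumℕ : List ℕ → ℕ
sumℕ = foldr ℕ._+_ 0

prodℚ : List ℚ → ℚ
prodℚ = foldr ℚ._*_ ℚ.1ℚ

-- p / d as a rational; the denominator d is always nonzero where used
-- (the value at d = 0 is an irrelevant junk value).
frac : ℤ → ℕ → ℚ
frac p zero    = ℚ.0ℚ
frac p (suc d) = p ℚ./ suc d

-- Triangles: a triangle is the list of its rows, top row first.
-- Entries are 1-indexed as in the paper: row i is  T ‼ (i ∸ 1),
-- entry a_{i,j} is  (row i) ‼ (j ∸ 1).  Index 0 never exists.

Triangle : Set
Triangle = List (List ℤ)

row : Triangle → ℕ → Maybe (List ℤ)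
row T zero    = nothing
row T (suc i) = T ‼ i

ent : Triangle → ℕ → ℕ → Maybe ℤ
ent T i zero    = nothing
ent T i (suc j) = row T i >>= λ r → r ‼ j

record IsHMT (n : ℕ) (T : Triangle) : Set where
  field
    order   : length T ≡ n
    shape   : ∀ i r → row T i ≡ just r → length r ≡ ⌈ i /2⌉
    rowInc  : ∀ i j x y → ent T i j ≡ just x → ent T i (suc j) ≡ just y → x ℤ.< y
    downL   : ∀ i j x y → ent T i j ≡ just x → ent T (suc i) j ≡ just y → y ℤ.≤ x
    downR   : ∀ i j x y → ent T i j ≡ just x → ent T (suc i) (suc j) ≡ just y → x ℤ.≤ y

BottomRow : ℕ → Triangle → List ℤ → Set
BottomRow n T k = row T n ≡ just k

BoundedBy : ℤ → Triangle → Set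
BoundedBy b T = ∀ i j x → ent T i j ≡ just x → x ℤ.≤ b

specialAt : Triangle → ℕ → ℕ → ℕ
specialAt T i j with ent T i j | ent T (suc i) j | ent T (suc i) (suc j)
... | just x | just y | just z  = if does (y ℤ.<? x) ∧ does (x ℤ.<? z) then 1 else 0
... | just x | just y | nothing = if does (y ℤ.<? x) then 1 else 0
... | _      | _      | _       = 0

-- number of special entries (positions outside the triangle contribute 0)
#special : Triangle → ℕ
#special T = sumℕ (concatMap (λ i → map (λ j → specialAt T i j) (oneTo (length T))) (oneTo (length T)))

weight : Triangle → ℕ
weight T = 2 ℕ.^ #special T

-- k_i, 1-indexed (junk value 0 outside range, never used)
kAt : {m : ℕ} → Vec ℤ m → ℕ → ℤ
kAt k zero    = + 0
kAt k (suc i) with Vec.toList k ‼ i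
... | just x  = x
... | nothing = + 0

pairs : ℕ → List (ℕ × ℕ)
pairs m = concatMap (λ j → map (λ i → (i , j)) (oneTo (j ∸ 1))) (oneTo m)

pairNum : {m : ℕ} → ℤ → Vec ℤ m → ℕ → ℕ → ℤ
pairNum b k i j = (kAt k j ℤ.- kAt k i) ℤ.* (+ 2 ℤ.* b ℤ.+ + 1 ℤ.- kAt k i ℤ.- kAt k j)

-- odd n, m = (n+1)/2
rhsOdd : (m : ℕ) → ℤ → Vec ℤ m → ℚ
rhsOdd m b k =
  (+ (4 ℕ.^ (m C 2)) ℚ./ 1) ℚ.*
  prodℚ (map (λ { (i , j) → frac (pairNum b k i j) ((j ∸ i) ℕ.* (i ℕ.+ j ∸ 1)) }) (pairs m))

-- even n, m = n/2
rhsEven : (m : ℕ) → ℤ → Vec ℤ m → ℚ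
rhsEven m b k =
  (+ (4 ℕ.^ (m C 2)) ℚ./ 1) ℚ.*
  prodℚ (map (λ { (i , j) → frac (pairNum b k i j) ((j ∸ i) ℕ.* (i ℕ.+ j)) }) (pairs m)) ℚ.*
  prodℚ (map (λ i → frac (+ 2 ℤ.* b ℤ.+ + 1 ℤ.- + 2 ℤ.* kAt k i) i) (oneTo m))

{-# OPTIONS --safe #-}
module Submission where

-- Put τ = 2b + 1 − 2x for an entry x.  Row by row, the generating function is an iterated
-- trapezoidal sum (weight 1 at the ends of the range of an entry, 2 inside).  If the previous
-- one is a determinant, its alternation kills the non-strict rows, so that the entries may be
-- summed independently; and the sum of a determinant is a determinant of summed columns.  The
-- integer polynomials E i, O i (of degrees 2i, 2i+1 in τ) are, up to integer factors,
-- trapezoidal antiderivatives of each other, the sum up to b fitting because τ(b) = 1 and O i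
-- is odd.  Telescoping and column operations then give, by induction on the order, that a
-- product of factorials times the generating function is det (E i (τ k_j)) for odd n and
-- det (O i (τ k_j)) for even n.  Both families satisfy monic three-term recurrences in w = −τ²,
-- which reduces these determinants to the Vandermonde determinant in w, where
-- w(k_j) − w(k_i) = 4 (k_j − k_i) (2b + 1 − k_i − k_j).

open import Defs
open import Data.Bool using (Bool; true; false; not; _∧_; if_then_else_)
open import Data.Empty using (⊥)
open import Data.Fin as Fin using (Fin)
open import Data.Integer as ℤ using (ℤ; +_; -[1+_]; _+_; _*_; _-_; -_)
import Data.Integer.Properties as ℤ
open import Data.Integer.Tactic.RingSolver using (solve-∀)
open import Data.List as List using (List; []; _∷_; _++_; _∷ʳ_; length; map; concatMap; cartesianProductWith; initLast; _∷ʳ′_)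
import Data.List.Properties as List
open import Data.List.Membership.Propositional using (_∈_; find; lose)
open import Data.List.Membership.Propositional.Properties
open import Data.List.Relation.Binary.Disjoint.Propositional using (Disjoint)
open import Data.List.Relation.Unary.All as All using (All; []; _∷_)
import Data.List.Relation.Unary.All.Properties as All
open import Data.List.Relation.Unary.AllPairs as AllPairs using ([]; _∷_)
import Data.List.Relation.Unary.AllPairs.Properties as AllPairs
open import Data.List.Relation.Unary.Any using (here; there)
open import Data.List.Relation.Unary.Unique.Propositional using (Unique)
import Data.List.Relation.Unary.Unique.Propositional.Properties as Unique
open import Data.Maybe using (Maybe; just; nothing)
open import Data.Maybe.Properties using (just-injective)
open import Data.Nat as ℕ using (ℕ; zero; suc; _≤_; _%_; _∸_; _!; ⌈_/2⌉; ⌊_/2⌋; s≤s; z≤n)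
open import Data.Nat.Combinatorics using (_C_; nC1≡n; nCk+nC[k+1]≡[n+1]C[k+1])
import Data.Nat.Properties as ℕ
open import Data.Product using (Σ; ∃; _×_; _,_; proj₁; proj₂)
open import Data.Rational as ℚ using (ℚ)
import Data.Rational.Properties as ℚ
open import Data.Rational.Unnormalised as ℚᵘ using (mkℚᵘ; *≡*)
import Data.Rational.Unnormalised.Properties as ℚᵘ
open import Data.Sum using (_⊎_; inj₁; inj₂)
open import Data.Vec as Vec using (Vec; []; _∷_; lookup)
open import Data.Vec.Properties using (length-toList)
open import Function using (_∘_)
open import Function.Bundles using (_⇔_; mk⇔)
open import Relation.Binary.PropositionalEquality using (_≡_; _≢_; refl; sym; trans; cong; cong₂; subst; module ≡-Reasoning)
import Relation.Binary.Reasoning.Setoid as SetoidReasoning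
open import Relation.Nullary using (does; yes; no; contradiction)
open import Relation.Nullary.Decidable using (dec-true; dec-false)

-- Alternating forms and determinants

-- The polynomials come from the series F(τ) = ((1 + t) / (1 - t))^(-τ/2). Raising an entry by 1
-- lowers τ by 2, which multiplies F by (1 + t) / (1 - t). Comparing coefficients in (1 - t) F(τ -
-- 2) = (1 + t) F(τ) says that consecutive coefficients are trapezoidal antiderivatives of each
-- other; the normalisation by n! in degree n produces the integer factors 2i + 1 and 2i + 2, and
-- their accumulated product is the common denominator of the formulas. The differential equation (1
-- - t²) F′ = - τ F gives the recurrences that define `E` and `O`. The signs are chosen so that
-- `E i` is monic in w and `O i` is τ times a monic polynomial in w.

wedge : {C : Set} → (C → ℤ) → (List C → ℤ) → List C → ℤ
wedge f ω []       = + 0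
-- Unfolded, this is the alternating sum over positions j of f at the j-th entry times `ω` of the
-- list without that entry; `ω` collects the entries already passed.
wedge f ω (x ∷ xs) = f x * ω xs - wedge f (λ ys → ω (x ∷ ys)) xs

-- Forms are functions on lists of every length. Since `unit` is 0 on nonempty lists, `det p i m`
-- vanishes off length m, and lengths need no tracking in types.
unit : {C : Set} → List C → ℤ
unit []      = + 1
unit (_ ∷ _) = + 0

-- The determinant of the rows p i, …, p (i + m ∸ 1), expanded along its first row.
det : {C : Set} → (ℕ → C → ℤ) → ℕ → ℕ → List C → ℤ
det p i zero    = unit
det p i (suc m) = wedge (p i) (det p (suc i) m)

module _ {C : Set} where

  -- The restriction to `V` serves columns that are ranges: their summation formulas hold only when
  -- the ends are in order.
  wedge-cong-All : (V : C → Set) {f f′ : C → ℤ} {ω ω′ : List C → ℤ} →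
    (∀ x → V x → f x ≡ f′ x) → (∀ xs → All V xs → ω xs ≡ ω′ xs) →
    ∀ xs → All V xs → wedge f ω xs ≡ wedge f′ ω′ xs
  wedge-cong-All V f≈ ω≈ []       []       = refl
  wedge-cong-All V f≈ ω≈ (x ∷ xs) (v ∷ vs) =
    cong₂ _-_ (cong₂ _*_ (f≈ x v) (ω≈ xs vs))
      (wedge-cong-All V f≈ (λ ys us → ω≈ (x ∷ ys) (v ∷ us)) xs vs)

  wedge-cong : ∀ {f f′ : C → ℤ} {ω ω′ : List C → ℤ} →
    (∀ x → f x ≡ f′ x) → (∀ xs → ω xs ≡ ω′ xs) →
    ∀ xs → wedge f ω xs ≡ wedge f′ ω′ xs
  wedge-cong f≈ ω≈ []       = refl
  wedge-cong f≈ ω≈ (x ∷ xs) =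
    cong₂ _-_ (cong₂ _*_ (f≈ x) (ω≈ xs)) (wedge-cong f≈ (ω≈ ∘ (x ∷_)) xs)

  wedge-congʳ : ∀ (f : C → ℤ) {ω ω′ : List C → ℤ} → (∀ xs → ω xs ≡ ω′ xs) →
    ∀ xs → wedge f ω xs ≡ wedge f ω′ xs
  wedge-congʳ f = wedge-cong (λ _ → refl)

  wedge-linearʳ : ∀ (f : C → ℤ) a b (ω η : List C → ℤ) xs →
    wedge f (λ ys → a * ω ys + b * η ys) xs ≡ a * wedge f ω xs + b * wedge f η xs
  wedge-linearʳ f a b ω η []       = lem a b
    where
    lem : ∀ a b → + 0 ≡ a * + 0 + b * + 0
    lem = solve-∀
  wedge-linearʳ f a b ω η (x ∷ xs)
    rewrite wedge-linearʳ f a b (ω ∘ (x ∷_)) (η ∘ (x ∷_)) xs =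
      lem a b (f x) (ω xs) (η xs) _ _
    where
    lem : ∀ a b c u v s t → c * (a * u + b * v) - (a * s + b * t) ≡ a * (c * u - s) + b * (c * v - t)
    lem = solve-∀

  wedge-linearˡ : ∀ a b (f g : C → ℤ) (ω : List C → ℤ) xs →
    wedge (λ x → a * f x + b * g x) ω xs ≡ a * wedge f ω xs + b * wedge g ω xs
  wedge-linearˡ a b f g ω []       = lem a b
    where
    lem : ∀ a b → + 0 ≡ a * + 0 + b * + 0
    lem = solve-∀
  wedge-linearˡ a b f g ω (x ∷ xs)
    rewrite wedge-linearˡ a b f g (ω ∘ (x ∷_)) xs =
      lem a b (f x) (g x) (ω xs) _ _
    where
    lem : ∀ a b c d u s t → (a * c + b * d) * u - (a * s + b * t) ≡ a * (c * u - s) + b * (d * u - t)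
    lem = solve-∀

  wedge-zeroʳ : ∀ (f : C → ℤ) xs → wedge f (λ _ → + 0) xs ≡ + 0
  wedge-zeroʳ f []       = refl
  wedge-zeroʳ f (x ∷ xs) rewrite wedge-zeroʳ f xs = lem (f x)
    where
    lem : ∀ c → c * + 0 - + 0 ≡ + 0
    lem = solve-∀

  wedge-scaleʳ : ∀ (f : C → ℤ) a (ω : List C → ℤ) xs →
    wedge f (λ ys → a * ω ys) xs ≡ a * wedge f ω xs
  wedge-scaleʳ f a ω xs = begin
    wedge f (λ ys → a * ω ys) xs
      ≡⟨ wedge-congʳ f (λ ys → lem₁ a (ω ys)) xs ⟩
    wedge f (λ ys → a * ω ys + + 0 * ω ys) xs
      ≡⟨ wedge-linearʳ f a (+ 0) ω ω xs ⟩
    a * wedge f ω xs + + 0 * wedge f ω xs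
      ≡⟨ lem₁ a _ ⟨
    a * wedge f ω xs ∎
    where
    open ≡-Reasoning
    lem₁ : ∀ a u → a * u ≡ a * u + + 0 * u
    lem₁ = solve-∀

  wedge-scaleˡ : ∀ a (f : C → ℤ) (ω : List C → ℤ) xs →
    wedge (λ x → a * f x) ω xs ≡ a * wedge f ω xs
  wedge-scaleˡ a f ω []       = sym (ℤ.*-zeroʳ a)
  wedge-scaleˡ a f ω (x ∷ xs) rewrite wedge-scaleˡ a f (ω ∘ (x ∷_)) xs =
    lem a (f x) (ω xs) _
    where
    lem : ∀ a c u s → a * c * u - a * s ≡ a * (c * u - s)
    lem = solve-∀

  -- Both sides sum over ordered pairs of deleted entries, and deleting a pair in the other order
  -- changes the sign.
  wedge-anticomm : ∀ (f g : C → ℤ) (ω : List C → ℤ) xs →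
    wedge f (wedge g ω) xs ≡ - wedge g (wedge f ω) xs
  wedge-anticomm f g ω []       = refl
  wedge-anticomm f g ω (x ∷ xs) = begin
    f x * wedge g ω xs - wedge f (λ ys → g x * ω ys - wedge g (ω ∘ (x ∷_)) ys) xs
      ≡⟨ cong (λ t → f x * wedge g ω xs - t) (expand f g) ⟩
    f x * wedge g ω xs - (g x * wedge f ω xs - wedge f (wedge g (ω ∘ (x ∷_))) xs)
      ≡⟨ cong (λ t → f x * wedge g ω xs - (g x * wedge f ω xs - t)) (wedge-anticomm f g (ω ∘ (x ∷_)) xs) ⟩
    f x * wedge g ω xs - (g x * wedge f ω xs - - wedge g (wedge f (ω ∘ (x ∷_))) xs)
      ≡⟨ lem (f x) _ (g x) _ _ ⟩
    - (g x * wedge f ω xs - (f x * wedge g ω xs - wedge g (wedge f (ω ∘ (x ∷_))) xs))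
      ≡⟨ cong (λ t → - (g x * wedge f ω xs - t)) (expand g f) ⟨
    - (g x * wedge f ω xs - wedge g (λ ys → f x * ω ys - wedge f (ω ∘ (x ∷_)) ys) xs) ∎
    where
    open ≡-Reasoning
    lem : ∀ a u b v w → a * u - (b * v - - w) ≡ - (b * v - (a * u - w))
    lem = solve-∀
    sub : ∀ a u v → a * u - v ≡ a * u + - + 1 * v
    sub = solve-∀
    expand : ∀ h k → wedge h (λ ys → k x * ω ys - wedge k (ω ∘ (x ∷_)) ys) xs
                   ≡ k x * wedge h ω xs - wedge h (wedge k (ω ∘ (x ∷_))) xs
    expand h k = begin
      wedge h (λ ys → k x * ω ys - wedge k (ω ∘ (x ∷_)) ys) xs
        ≡⟨ wedge-congʳ h (λ ys → sub (k x) (ω ys) _) xs ⟩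
      wedge h (λ ys → k x * ω ys + - + 1 * wedge k (ω ∘ (x ∷_)) ys) xs
        ≡⟨ wedge-linearʳ h (k x) (- + 1) ω (wedge k (ω ∘ (x ∷_))) xs ⟩
      k x * wedge h ω xs + - + 1 * wedge h (wedge k (ω ∘ (x ∷_))) xs
        ≡⟨ sub (k x) _ _ ⟨
      k x * wedge h ω xs - wedge h (wedge k (ω ∘ (x ∷_))) xs ∎

  -- By anticommutation the value equals its negative, and ℤ has no 2-torsion.
  wedge-self : ∀ (f : C → ℤ) (ω : List C → ℤ) xs → wedge f (wedge f ω) xs ≡ + 0
  wedge-self f ω xs = self-neg (wedge-anticomm f f ω xs)
    where
    self-neg : ∀ {i} → i ≡ - i → i ≡ + 0
    self-neg {+ zero}   _  = refl
    self-neg {+ suc _}  ()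
    self-neg {ℤ.-[1+ _ ]} ()

  -- A row operation with the two preceding rows, which is as far back as a three-term recurrence
  -- reaches.
  wedge-reduce : ∀ (f g h : C → ℤ) a b (ω : List C → ℤ) xs →
    wedge f (wedge g (wedge (λ x → h x + a * g x + b * f x) ω)) xs ≡ wedge f (wedge g (wedge h ω)) xs
  wedge-reduce f g h a b ω xs = begin
    wedge f (wedge g (wedge (λ x → h x + a * g x + b * f x) ω)) xs
      ≡⟨ wedge-congʳ f (λ ys → trans (wedge-congʳ g expand ys) (expand′ ys)) xs ⟩
    wedge f (λ ys → + 1 * wedge g (wedge h ω) ys + b * wedge g (wedge f ω) ys) xs
      ≡⟨ wedge-linearʳ f (+ 1) b (wedge g (wedge h ω)) (wedge g (wedge f ω)) xs ⟩
    + 1 * wedge f (wedge g (wedge h ω)) xs + b * wedge f (wedge g (wedge f ω)) xs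
      ≡⟨ cong (λ t → + 1 * wedge f (wedge g (wedge h ω)) xs + b * t) vanish ⟩
    + 1 * wedge f (wedge g (wedge h ω)) xs + b * + 0
      ≡⟨ lem₄ _ b ⟩
    wedge f (wedge g (wedge h ω)) xs ∎
    where
    open ≡-Reasoning
    lem₁ : ∀ a b u v w → w + a * v + b * u ≡ + 1 * (+ 1 * w + a * v) + b * u
    lem₁ = solve-∀
    lem₃ : ∀ b u w a → + 1 * (+ 1 * w + a * + 0) + b * u ≡ + 1 * w + b * u
    lem₃ = solve-∀
    lem₄ : ∀ u b → + 1 * u + b * + 0 ≡ u
    lem₄ = solve-∀
    expand : ∀ ys → wedge (λ x → h x + a * g x + b * f x) ω ys
      ≡ + 1 * (+ 1 * wedge h ω ys + a * wedge g ω ys) + b * wedge f ω ys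
    expand ys = begin
      wedge (λ x → h x + a * g x + b * f x) ω ys
        ≡⟨ wedge-cong (λ x → lem₁ a b (f x) (g x) (h x)) (λ _ → refl) ys ⟩
      wedge (λ x → + 1 * (+ 1 * h x + a * g x) + b * f x) ω ys
        ≡⟨ wedge-linearˡ (+ 1) b (λ x → + 1 * h x + a * g x) f ω ys ⟩
      + 1 * wedge (λ x → + 1 * h x + a * g x) ω ys + b * wedge f ω ys
        ≡⟨ cong (λ t → + 1 * t + b * wedge f ω ys) (wedge-linearˡ (+ 1) a h g ω ys) ⟩
      + 1 * (+ 1 * wedge h ω ys + a * wedge g ω ys) + b * wedge f ω ys ∎
    expand′ : ∀ ys → wedge g (λ zs → + 1 * (+ 1 * wedge h ω zs + a * wedge g ω zs) + b * wedge f ω zs) ys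
      ≡ + 1 * wedge g (wedge h ω) ys + b * wedge g (wedge f ω) ys
    expand′ ys = begin
      wedge g (λ zs → + 1 * (+ 1 * wedge h ω zs + a * wedge g ω zs) + b * wedge f ω zs) ys
        ≡⟨ wedge-linearʳ g (+ 1) b (λ zs → + 1 * wedge h ω zs + a * wedge g ω zs) (wedge f ω) ys ⟩
      + 1 * wedge g (λ zs → + 1 * wedge h ω zs + a * wedge g ω zs) ys + b * wedge g (wedge f ω) ys
        ≡⟨ cong (λ t → + 1 * t + b * wedge g (wedge f ω) ys) (wedge-linearʳ g (+ 1) a (wedge h ω) (wedge g ω) ys) ⟩
      + 1 * (+ 1 * wedge g (wedge h ω) ys + a * wedge g (wedge g ω) ys) + b * wedge g (wedge f ω) ys
        ≡⟨ cong (λ t → + 1 * (+ 1 * wedge g (wedge h ω) ys + a * t) + b * wedge g (wedge f ω) ys) (wedge-self g ω ys) ⟩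
      + 1 * (+ 1 * wedge g (wedge h ω) ys + a * + 0) + b * wedge g (wedge f ω) ys
        ≡⟨ lem₃ b (wedge g (wedge f ω) ys) (wedge g (wedge h ω) ys) a ⟩
      + 1 * wedge g (wedge h ω) ys + b * wedge g (wedge f ω) ys ∎
    vanish : wedge f (wedge g (wedge f ω)) xs ≡ + 0
    vanish = trans (wedge-anticomm f g (wedge f ω) xs)
      (cong -_ (trans (wedge-congʳ g (wedge-self f ω) xs) (wedge-zeroʳ g xs)))

  -- Adjacent repetitions are the ones that occur: neighbouring gaps share an endpoint, and a
  -- non-strict weakly increasing row repeats an entry side by side.
  Alternating : (List C → ℤ) → Set
  Alternating ω = ∀ xs y zs → ω (xs ++ y ∷ y ∷ zs) ≡ + 0

  alternating-∷ : ∀ {ω : List C → ℤ} → Alternating ω → ∀ x → Alternating (ω ∘ (x ∷_))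
  alternating-∷ alt x xs = alt (x ∷ xs)

  -- The two terms that delete one of the equal entries cancel; in every other term the repetition
  -- reaches `ω`.
  wedge-alternating : ∀ (f : C → ℤ) {ω : List C → ℤ} → Alternating ω → Alternating (wedge f ω)
  wedge-alternating f {ω} alt [] y zs
    rewrite trans (wedge-congʳ f (alt [] y) zs) (wedge-zeroʳ f zs) = lem (f y * ω (y ∷ zs))
    where
    lem : ∀ u → u - (u - + 0) ≡ + 0
    lem = solve-∀
  wedge-alternating f {ω} alt (x ∷ xs) y zs
    = trans (cong₂ (λ s t → f x * s - t) (alt xs y zs)
        (wedge-alternating f {ω ∘ (x ∷_)} (alternating-∷ {ω} alt x) xs y zs)) (lem (f x))
    where
    lem : ∀ u → u * + 0 - + 0 ≡ + 0
    lem = solve-∀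

  det-alternating : ∀ (p : ℕ → C → ℤ) i m → Alternating (det p i m)
  det-alternating p i zero    []       y zs = refl
  det-alternating p i zero    (_ ∷ _)  y zs = refl
  det-alternating p i (suc m) = wedge-alternating (p i) {det p (suc i) m} (det-alternating p (suc i) m)

  ∏ℤ : (C → ℤ) → List C → ℤ
  ∏ℤ u []       = + 1
  ∏ℤ u (x ∷ xs) = u x * ∏ℤ u xs

  wedge-scale-columns : ∀ (u f : C → ℤ) {ω ω′ : List C → ℤ} →
    (∀ ys → ω′ ys ≡ ∏ℤ u ys * ω ys) →
    ∀ xs → wedge (λ x → u x * f x) ω′ xs ≡ ∏ℤ u xs * wedge f ω xs
  wedge-scale-columns u f ω′≈ []       = refl
  wedge-scale-columns u f {ω} {ω′} ω′≈ (x ∷ xs) = begin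
    u x * f x * ω′ xs - wedge (λ y → u y * f y) (ω′ ∘ (x ∷_)) xs
      ≡⟨ cong₂ (λ s t → u x * f x * s - t) (ω′≈ xs)
           (wedge-scale-columns u f (λ ys → trans (ω′≈ (x ∷ ys)) (lem₁ (u x) _ _)) xs) ⟩
    u x * f x * (∏ℤ u xs * ω xs) - ∏ℤ u xs * wedge f (λ ys → u x * ω (x ∷ ys)) xs
      ≡⟨ cong (λ t → u x * f x * (∏ℤ u xs * ω xs) - ∏ℤ u xs * t) (wedge-scaleʳ f (u x) (ω ∘ (x ∷_)) xs) ⟩
    u x * f x * (∏ℤ u xs * ω xs) - ∏ℤ u xs * (u x * wedge f (ω ∘ (x ∷_)) xs)
      ≡⟨ lem₂ (u x) (f x) _ _ _ ⟩
    u x * ∏ℤ u xs * (f x * ω xs - wedge f (ω ∘ (x ∷_)) xs) ∎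
    where
    open ≡-Reasoning
    lem₁ : ∀ a b c → a * b * c ≡ b * (a * c)
    lem₁ = solve-∀
    lem₂ : ∀ a b c d e → a * b * (c * d) - c * (a * e) ≡ a * c * (b * d - e)
    lem₂ = solve-∀

  det-scale-columns : ∀ (u : C → ℤ) p i m xs →
    det (λ j x → u x * p j x) i m xs ≡ ∏ℤ u xs * det p i m xs
  det-scale-columns u p i zero    []       = refl
  det-scale-columns u p i zero    (x ∷ xs) = sym (ℤ.*-zeroʳ (∏ℤ u (x ∷ xs)))
  det-scale-columns u p i (suc m) = wedge-scale-columns u (p i) (det-scale-columns u p (suc i) m)

  det-shift : ∀ (p : ℕ → C → ℤ) i m xs → det (p ∘ suc) i m xs ≡ det p (suc i) m xs
  det-shift p i zero    xs = refl
  det-shift p i (suc m) = wedge-congʳ (p (suc i)) (det-shift p (suc i) m)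

  wedge-vanish : ∀ (f : C → ℤ) x {ω : List C → ℤ} → (∀ ys → ω (x ∷ ys) ≡ + 0) →
    ∀ xs → wedge f ω (x ∷ xs) ≡ f x * ω xs
  wedge-vanish f x {ω} ω≈0 xs
    rewrite trans (wedge-congʳ f ω≈0 xs) (wedge-zeroʳ f xs) = ℤ.+-identityʳ _

  det-vanish : ∀ (p : ℕ → C → ℤ) i m x → (∀ j → p j x ≡ + 0) →
    ∀ xs → det p i m (x ∷ xs) ≡ + 0
  det-vanish p i zero    x px≈0 xs = refl
  det-vanish p i (suc m) x px≈0 xs
    rewrite px≈0 i | trans (wedge-congʳ (p i) (det-vanish p (suc i) m x px≈0) xs) (wedge-zeroʳ (p i) xs) = refl

  -- Vandermonde evaluation for rows with a three-term recurrence

  vandermonde : (C → ℤ) → List C → ℤ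
  vandermonde w []       = + 1
  vandermonde w (x ∷ xs) = ∏ℤ (λ y → w y - w x) xs * vandermonde w xs

  module ThreeTerm (p : ℕ → C → ℤ) (w : C → ℤ) (α γ : ℕ → ℤ)
    (p₁ : ∀ x → p 1 x ≡ (w x + α 0) * p 0 x)
    (p₊ : ∀ i x → p (2 ℕ.+ i) x ≡ (w x + α (suc i)) * p (suc i) x + γ i * p i x) where

    -- Modulo the rows above it, row suc i is (w - t) times row i, for any constant t.
    private
      q : ℤ → ℕ → C → ℤ
      q t zero    x = p 0 x
      q t (suc i) x = (w x - t) * p i x

    -- The two rows in front already belong to `p`, so the recurrence turns the next row of `q t`
    -- into one of `p` by a row operation, and the window moves down by one.
    reduce : ∀ t i m xs →
      wedge (p i) (wedge (p (suc i)) (det (q t) (2 ℕ.+ i) m)) xs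
        ≡ wedge (p i) (wedge (p (suc i)) (det p (2 ℕ.+ i) m)) xs
    reduce t i zero    xs = refl
    reduce t i (suc m) xs = begin
      wedge (p i) (wedge (p (suc i)) (wedge (q t (2 ℕ.+ i)) (det (q t) (3 ℕ.+ i) m))) xs
        ≡⟨ wedge-congʳ (p i) (wedge-congʳ (p (suc i)) (wedge-cong step (λ _ → refl))) xs ⟩
      wedge (p i) (wedge (p (suc i)) (wedge (λ x → p (2 ℕ.+ i) x + (- t - α (suc i)) * p (suc i) x + - γ i * p i x) (det (q t) (3 ℕ.+ i) m))) xs
        ≡⟨ wedge-reduce (p i) (p (suc i)) (p (2 ℕ.+ i)) (- t - α (suc i)) (- γ i) _ xs ⟩
      wedge (p i) (wedge (p (suc i)) (wedge (p (2 ℕ.+ i)) (det (q t) (3 ℕ.+ i) m))) xs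
        ≡⟨ wedge-congʳ (p i) (reduce t (suc i) m) xs ⟩
      wedge (p i) (wedge (p (suc i)) (wedge (p (2 ℕ.+ i)) (det p (3 ℕ.+ i) m))) xs ∎
      where
      open ≡-Reasoning
      lem : ∀ t w a c u v → (w - t) * u ≡ ((w + a) * u + c * v) + (- t - a) * u + - c * v
      lem = solve-∀
      step : ∀ x → q t (2 ℕ.+ i) x ≡ p (2 ℕ.+ i) x + (- t - α (suc i)) * p (suc i) x + - γ i * p i x
      step x rewrite p₊ i x = lem t (w x) (α (suc i)) (γ i) (p (suc i) x) (p i x)

    -- Row 1 has a single row above it and is treated through `p₁`; from there on the window of
    -- `reduce` is available.
    det-reduce : ∀ t m xs → det (q t) 0 m xs ≡ det p 0 m xs
    det-reduce t zero          xs = refl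
    det-reduce t (suc zero)    xs = refl
    det-reduce t (suc (suc m)) xs = begin
      wedge (p 0) (wedge (q t 1) ω) xs
        ≡⟨ wedge-congʳ (p 0) (λ ys → trans (wedge-cong step (λ _ → refl) ys) (wedge-linearˡ (+ 1) (- t - α 0) (p 1) (p 0) ω ys)) xs ⟩
      wedge (p 0) (λ ys → + 1 * wedge (p 1) ω ys + (- t - α 0) * wedge (p 0) ω ys) xs
        ≡⟨ wedge-linearʳ (p 0) (+ 1) (- t - α 0) (wedge (p 1) ω) (wedge (p 0) ω) xs ⟩
      + 1 * wedge (p 0) (wedge (p 1) ω) xs + (- t - α 0) * wedge (p 0) (wedge (p 0) ω) xs
        ≡⟨ cong (λ s → + 1 * wedge (p 0) (wedge (p 1) ω) xs + (- t - α 0) * s) (wedge-self (p 0) ω xs) ⟩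
      + 1 * wedge (p 0) (wedge (p 1) ω) xs + (- t - α 0) * + 0
        ≡⟨ lem₂ (- t - α 0) _ ⟩
      wedge (p 0) (wedge (p 1) ω) xs
        ≡⟨ reduce t 0 m xs ⟩
      wedge (p 0) (wedge (p 1) (det p 2 m)) xs ∎
      where
      open ≡-Reasoning
      ω = det (q t) 2 m
      lem : ∀ t w a u → (w - t) * u ≡ + 1 * ((w + a) * u) + (- t - a) * u
      lem = solve-∀
      lem₂ : ∀ a u → + 1 * u + a * + 0 ≡ u
      lem₂ = solve-∀
      step : ∀ x → q t 1 x ≡ + 1 * p 1 x + (- t - α 0) * p 0 x
      step x rewrite p₁ x = lem t (w x) (α 0) (p 0 x)

    -- For t = w x every row of `q t` after the first vanishes at x. Hence one term of the expansion
    -- survives, and the factors w y - w x come out of the columns: the usual Vandermonde induction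
    -- with `p` in place of the monomials.
    det≡vandermonde : ∀ xs → det p 0 (length xs) xs ≡ ∏ℤ (p 0) xs * vandermonde w xs
    det≡vandermonde []       = refl
    det≡vandermonde (x ∷ xs) = begin
      det p 0 (suc m) (x ∷ xs)
        ≡⟨ det-reduce (w x) (suc m) (x ∷ xs) ⟨
      wedge (p 0) (det (q (w x)) 1 m) (x ∷ xs)
        ≡⟨ wedge-congʳ (p 0) (det-shift (q (w x)) 0 m) (x ∷ xs) ⟨
      wedge (p 0) (det q′ 0 m) (x ∷ xs)
        ≡⟨ wedge-vanish (p 0) x {det q′ 0 m} (det-vanish q′ 0 m x (λ j → lem₁ (w x) (p j x))) xs ⟩
      p 0 x * det q′ 0 m xs
        ≡⟨ cong (p 0 x *_) (det-scale-columns (λ y → w y - w x) p 0 m xs) ⟩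
      p 0 x * (∏ℤ (λ y → w y - w x) xs * det p 0 m xs)
        ≡⟨ cong (λ s → p 0 x * (∏ℤ (λ y → w y - w x) xs * s)) (det≡vandermonde xs) ⟩
      p 0 x * (∏ℤ (λ y → w y - w x) xs * (∏ℤ (p 0) xs * vandermonde w xs))
        ≡⟨ lem₂ (p 0 x) (∏ℤ (λ y → w y - w x) xs) (∏ℤ (p 0) xs) (vandermonde w xs) ⟩
      p 0 x * ∏ℤ (p 0) xs * (∏ℤ (λ y → w y - w x) xs * vandermonde w xs) ∎
      where
      open ≡-Reasoning
      m = length xs
      q′ : ℕ → C → ℤ
      q′ j y = (w y - w x) * p j y
      lem₁ : ∀ w u → (w - w) * u ≡ + 0
      lem₁ = solve-∀
      lem₂ : ∀ a b c d → a * (b * (c * d)) ≡ a * c * (b * d)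
      lem₂ = solve-∀

-- Iterated weighted sums

-- A finite signed measure, as a list of masses and points. It stands both for the weighted range of
-- an entry and for the signed endpoints left by telescoping.
weighted : {A : Set} → List (ℤ × A) → (A → ℤ) → ℤ
weighted []             f = + 0
weighted ((a , t) ∷ ts) f = a * f t + weighted ts f

module _ {A : Set} where

  weighted-cong : ∀ (ts : List (ℤ × A)) {f g : A → ℤ} → (∀ t → f t ≡ g t) → weighted ts f ≡ weighted ts g
  weighted-cong []             f≈g = refl
  weighted-cong ((a , t) ∷ ts) f≈g = cong₂ (λ u v → a * u + v) (f≈g t) (weighted-cong ts f≈g)

  weighted-linear : ∀ (ts : List (ℤ × A)) a b (f g : A → ℤ) →
    weighted ts (λ t → a * f t + b * g t) ≡ a * weighted ts f + b * weighted ts g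
  weighted-linear []             a b f g = lem a b
    where
    lem : ∀ a b → + 0 ≡ a * + 0 + b * + 0
    lem = solve-∀
  weighted-linear ((c , t) ∷ ts) a b f g rewrite weighted-linear ts a b f g = lem a b c (f t) (g t) _ _
    where
    lem : ∀ a b c u v s t → c * (a * u + b * v) + (a * s + b * t) ≡ a * (c * u + s) + b * (c * v + t)
    lem = solve-∀

  weighted-zero : ∀ (ts : List (ℤ × A)) → weighted ts (λ _ → + 0) ≡ + 0
  weighted-zero []             = refl
  weighted-zero ((a , t) ∷ ts) rewrite weighted-zero ts | ℤ.*-zeroʳ a = refl

  weighted-sub : ∀ (ts : List (ℤ × A)) (f g : A → ℤ) c →
    weighted ts (λ t → f t * c - g t) ≡ weighted ts f * c - weighted ts g
  weighted-sub ts f g c = begin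
    weighted ts (λ t → f t * c - g t)               ≡⟨ weighted-cong ts (λ t → lem (f t) c (g t)) ⟩
    weighted ts (λ t → c * f t + - + 1 * g t)       ≡⟨ weighted-linear ts c (- + 1) f g ⟩
    c * weighted ts f + - + 1 * weighted ts g       ≡⟨ lem (weighted ts f) c (weighted ts g) ⟨
    weighted ts f * c - weighted ts g               ∎
    where
    open ≡-Reasoning
    lem : ∀ u c v → u * c - v ≡ c * u + - + 1 * v
    lem = solve-∀

  wedge-weighted : ∀ {C : Set} (f : C → ℤ) (ts : List (ℤ × A)) (ω : A → List C → ℤ) xs →
    wedge f (λ ys → weighted ts (λ t → ω t ys)) xs ≡ weighted ts (λ t → wedge f (ω t) xs)
  wedge-weighted f []             ω xs = wedge-zeroʳ f xs
  wedge-weighted f ((a , t) ∷ ts) ω xs = begin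
    wedge f (λ ys → a * ω t ys + weighted ts (λ s → ω s ys)) xs
      ≡⟨ wedge-congʳ f (λ ys → cong (λ v → a * ω t ys + v) (sym (ℤ.*-identityˡ (weighted ts (λ s → ω s ys))))) xs ⟩
    wedge f (λ ys → a * ω t ys + + 1 * weighted ts (λ s → ω s ys)) xs
      ≡⟨ wedge-linearʳ f a (+ 1) (ω t) (λ ys → weighted ts (λ s → ω s ys)) xs ⟩
    a * wedge f (ω t) xs + + 1 * wedge f (λ ys → weighted ts (λ s → ω s ys)) xs
      ≡⟨ cong (λ v → a * wedge f (ω t) xs + v) (trans (ℤ.*-identityˡ _) (wedge-weighted f ts ω xs)) ⟩
    a * wedge f (ω t) xs + weighted ts (λ s → wedge f (ω s) xs) ∎
    where open ≡-Reasoning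

module _ {A J : Set} (φ : J → List (ℤ × A)) where

  sumOver : List J → (List A → ℤ) → ℤ
  sumOver []       F = F []
  sumOver (j ∷ js) F = weighted (φ j) (λ t → sumOver js (λ ts → F (t ∷ ts)))

  sumOver-cong : ∀ js {F G : List A → ℤ} → (∀ ts → F ts ≡ G ts) → sumOver js F ≡ sumOver js G
  sumOver-cong []       F≈G = F≈G []
  sumOver-cong (j ∷ js) F≈G = weighted-cong (φ j) (λ t → sumOver-cong js (λ ts → F≈G (t ∷ ts)))

  sumOver-zero : ∀ js → sumOver js (λ _ → + 0) ≡ + 0
  sumOver-zero []       = refl
  sumOver-zero (j ∷ js) = trans (weighted-cong (φ j) (λ _ → sumOver-zero js)) (weighted-zero (φ j))

  sumOver-linear : ∀ js a b (F G : List A → ℤ) →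
    sumOver js (λ ts → a * F ts + b * G ts) ≡ a * sumOver js F + b * sumOver js G
  sumOver-linear []       a b F G = refl
  sumOver-linear (j ∷ js) a b F G = trans
    (weighted-cong (φ j) (λ t → sumOver-linear js a b (F ∘ (t ∷_)) (G ∘ (t ∷_))))
    (weighted-linear (φ j) a b _ _)

  sumOver-sub : ∀ js a (F G : List A → ℤ) →
    sumOver js (λ ts → a * F ts - G ts) ≡ a * sumOver js F - sumOver js G
  sumOver-sub js a F G = begin
    sumOver js (λ ts → a * F ts - G ts)           ≡⟨ sumOver-cong js (λ ts → lem a (F ts) (G ts)) ⟩
    sumOver js (λ ts → a * F ts + - + 1 * G ts)   ≡⟨ sumOver-linear js a (- + 1) F G ⟩
    a * sumOver js F + - + 1 * sumOver js G       ≡⟨ lem a (sumOver js F) (sumOver js G) ⟨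
    a * sumOver js F - sumOver js G               ∎
    where
    open ≡-Reasoning
    lem : ∀ c u v → c * u - v ≡ c * u + - + 1 * v
    lem = solve-∀

  -- Multilinearity: each column is summed over its own range, so the ranges themselves become the
  -- columns of the new form.
  sumOver-wedge : ∀ (g : A → ℤ) (ω : List A → ℤ) js →
    sumOver js (wedge g ω) ≡ wedge (λ j → weighted (φ j) g) (λ is → sumOver is ω) js
  sumOver-wedge g ω []       = refl
  sumOver-wedge g ω (j ∷ js) = begin
    weighted (φ j) (λ t → sumOver js (λ ts → g t * ω ts - wedge g (ω ∘ (t ∷_)) ts))
      ≡⟨ weighted-cong (φ j) (λ t → sumOver-sub js (g t) ω (wedge g (ω ∘ (t ∷_)))) ⟩
    weighted (φ j) (λ t → g t * sumOver js ω - sumOver js (wedge g (ω ∘ (t ∷_))))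
      ≡⟨ weighted-cong (φ j) (λ t → cong (λ v → g t * sumOver js ω - v) (sumOver-wedge g (ω ∘ (t ∷_)) js)) ⟩
    weighted (φ j) (λ t → g t * sumOver js ω - wedge ĝ (λ is → sumOver is (ω ∘ (t ∷_))) js)
      ≡⟨ weighted-sub (φ j) g _ (sumOver js ω) ⟩
    ĝ j * sumOver js ω - weighted (φ j) (λ t → wedge ĝ (λ is → sumOver is (ω ∘ (t ∷_))) js)
      ≡⟨ cong (λ v → ĝ j * sumOver js ω - v) (wedge-weighted ĝ (φ j) (λ t is → sumOver is (ω ∘ (t ∷_))) js) ⟨
    ĝ j * sumOver js ω - wedge ĝ (λ is → weighted (φ j) (λ t → sumOver is (ω ∘ (t ∷_)))) js ∎
    where
    open ≡-Reasoning
    ĝ : J → ℤ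
    ĝ i = weighted (φ i) g

  sumOver-det : ∀ (p : ℕ → A → ℤ) i m js →
    sumOver js (det p i m) ≡ det (λ l j → weighted (φ j) (p l)) i m js
  sumOver-det p i zero    []       = refl
  sumOver-det p i zero    (j ∷ js) = sumOver-zero (j ∷ js)
  sumOver-det p i (suc m) js = trans (sumOver-wedge (p i) (det p (suc i) m) js)
    (wedge-congʳ _ (sumOver-det p (suc i) m) js)

∏ₙ : (ℕ → ℤ) → ℕ → ℕ → ℤ
∏ₙ c i zero    = + 1
∏ₙ c i (suc m) = c i * ∏ₙ c (suc i) m

det-scale-All : ∀ {C : Set} (V : C → Set) (c : ℕ → ℤ) {p q : ℕ → C → ℤ} →
  (∀ i x → V x → c i * p i x ≡ q i x) →
  ∀ i m xs → All V xs → ∏ₙ c i m * det p i m xs ≡ det q i m xs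
det-scale-All V c         pq i zero    xs vs = ℤ.*-identityˡ (unit xs)
det-scale-All V c {p} {q} pq i (suc m) xs vs = begin
  c i * ∏ₙ c (suc i) m * wedge (p i) (det p (suc i) m) xs
    ≡⟨ ℤ.*-assoc (c i) (∏ₙ c (suc i) m) _ ⟩
  c i * (∏ₙ c (suc i) m * wedge (p i) (det p (suc i) m) xs)
    ≡⟨ cong (c i *_) (wedge-scaleʳ (p i) (∏ₙ c (suc i) m) (det p (suc i) m) xs) ⟨
  c i * wedge (p i) (λ ys → ∏ₙ c (suc i) m * det p (suc i) m ys) xs
    ≡⟨ wedge-scaleˡ (c i) (p i) _ xs ⟨
  wedge (λ x → c i * p i x) (λ ys → ∏ₙ c (suc i) m * det p (suc i) m ys) xs
    ≡⟨ wedge-cong-All V (pq i) (det-scale-All V c pq (suc i) m) xs vs ⟩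
  wedge (q i) (det q (suc i) m) xs ∎
  where open ≡-Reasoning

-- gap x y is the range of an entry between the two entries x and y of the row below,
-- end x that of the last entry of an odd row, which has only x below it.
data Range : Set where
  gap : ℤ → ℤ → Range
  end : ℤ → Range

-- The polynomials E and O, and the two summation steps

-- Up to sign, the Mittag-Leffler polynomials n! [tⁿ] ((1 + t) / (1 - t))^(-τ/2) with n = 2i and n = 2i + 1.
E O : ℕ → ℤ → ℤ
E zero    τ = + 1
E (suc i) τ = - (τ * O i τ) - (+ 2 * + i + + 1) * (+ 2 * + i) * E i τ
O zero    τ = τ
O (suc i) τ = τ * E (suc i) τ - (+ 2 * + i + + 2) * (+ 2 * + i + + 1) * O i τ

-- Named after the parity of the order that is reached: summing `E i` leads to even order and costs
-- `evenC i`, summing `O i` leads to odd order and costs `oddC i`.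
evenC oddC : ℕ → ℤ
evenC i = + 2 * + i + + 1
oddC  i = + 2 * + i + + 2

-- Ideal membership as a proof method: a consequence of l ≡ r and l′ ≡ r′ is certified by a
-- polynomial identity with explicit multipliers a and b.
cancel₂ : ∀ {x y l r l′ r′} a b → x ≡ y + (a * (l - r) + b * (l′ - r′)) → l ≡ r → l′ ≡ r′ → x ≡ y
cancel₂ {x} {y} {l} {_} {l′} a b eq refl refl = trans eq (lem y a b l l′)
  where
  lem : ∀ y a b l l′ → y + (a * (l - l) + b * (l′ - l′)) ≡ y
  lem = solve-∀

cancel₁ : ∀ {x y l r} a → x ≡ y + a * (l - r) → l ≡ r → x ≡ y
cancel₁ {x} {y} {l} a eq refl = trans eq (lem y a l)
  where
  lem : ∀ y a l → y + a * (l - l) ≡ y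
  lem = solve-∀

-- Both steps compare coefficients in (1 - t) F(τ - 2) = (1 + t) F(τ), at t^(2i+2) here and at
-- t^(2i+1) in `O-step`; the factor is the quotient of the two factorials involved. The proof is a
-- mutual induction along the recurrences.
E-step : ∀ i τ → E (suc i) (τ - + 2) - E (suc i) τ ≡ oddC i * (O i τ + O i (τ - + 2))
O-step : ∀ i τ → O i τ - O i (τ - + 2) ≡ evenC i * (E i τ + E i (τ - + 2))

E-step zero    τ = lem τ
  where
  lem : ∀ τ → (- ((τ - + 2) * (τ - + 2)) - + 0) - (- (τ * τ) - + 0) ≡ + 2 * (τ + (τ - + 2))
  lem = solve-∀
-- Let a be `O (suc i)` at τ and a′ its value at τ - 2. The split τ a - (τ - 2) a′ = (τ - 1)(a - a′)
-- + (a + a′) gives the multiplier τ - 1 of `O-step (suc i)`; the remaining terms are a multiple of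
-- `E-step i`.
E-step (suc i) τ = cancel₂ (- (+ 2 * + i + + 3) * (+ 2 * + i + + 1)) (τ - + 1)
    (lem (+ i) τ (E (suc i) τ) (E (suc i) (τ - + 2)) (O i τ) (O i (τ - + 2)))
    (E-step i τ) (O-step (suc i) τ)
  where
  lem : ∀ I τ e e′ o o′ →
    let o₁  = τ * e - (+ 2 * I + + 2) * (+ 2 * I + + 1) * o
        o₁′ = (τ - + 2) * e′ - (+ 2 * I + + 2) * (+ 2 * I + + 1) * o′
        J   = + 1 + I
    in (- ((τ - + 2) * o₁′) - (+ 2 * J + + 1) * (+ 2 * J) * e′) - (- (τ * o₁) - (+ 2 * J + + 1) * (+ 2 * J) * e)
       ≡ (+ 2 * J + + 2) * (o₁ + o₁′)
         + ((- (+ 2 * I + + 3) * (+ 2 * I + + 1)) * ((e′ - e) - (+ 2 * I + + 2) * (o + o′))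
            + (τ - + 1) * ((o₁ - o₁′) - (+ 2 * J + + 1) * (e + e′)))
  lem = solve-∀

O-step zero    τ = lem τ
  where
  lem : ∀ τ → τ - (τ - + 2) ≡ + 1 * (+ 1 + + 1)
  lem = solve-∀
O-step (suc i) τ = cancel₂ (+ 1 - τ) (- (+ 2 * + i + + 2) * (+ 2 * + i))
    (lem (+ i) τ (E i τ) (E i (τ - + 2)) (O i τ) (O i (τ - + 2)))
    (E-step i τ) (O-step i τ)
  where
  lem : ∀ I τ e e′ o o′ →
    let e₁  = - (τ * o) - (+ 2 * I + + 1) * (+ 2 * I) * e
        e₁′ = - ((τ - + 2) * o′) - (+ 2 * I + + 1) * (+ 2 * I) * e′
        J   = + 1 + I
    in (τ * e₁ - (+ 2 * I + + 2) * (+ 2 * I + + 1) * o) - ((τ - + 2) * e₁′ - (+ 2 * I + + 2) * (+ 2 * I + + 1) * o′)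
       ≡ (+ 2 * J + + 1) * (e₁ + e₁′)
         + ((+ 1 - τ) * ((e₁′ - e₁) - (+ 2 * I + + 2) * (o + o′))
            + (- (+ 2 * I + + 2) * (+ 2 * I)) * ((o - o′) - (+ 2 * I + + 1) * (e + e′)))
  lem = solve-∀

-- This is `O-step` at τ = 1, halved, as `O i` is odd and `E i` even. The recurrences at τ = 1 give
-- it without division by 2.
O-one : ∀ i → O i (+ 1) ≡ evenC i * E i (+ 1)
O-one zero    = refl
O-one (suc i) = cancel₁ (- (+ 2 * + i + + 2) * (+ 2 * + i))
    (lem (+ i) (E i (+ 1)) (O i (+ 1))) (O-one i)
  where
  lem : ∀ I e o →
    let e₁ = - (+ 1 * o) - (+ 2 * I + + 1) * (+ 2 * I) * e
        J  = + 1 + I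
    in + 1 * e₁ - (+ 2 * I + + 2) * (+ 2 * I + + 1) * o
       ≡ (+ 2 * J + + 1) * e₁ + (- (+ 2 * I + + 2) * (+ 2 * I)) * (o - (+ 2 * I + + 1) * e)
  lem = solve-∀

-- Eliminating `O` from the two recurrences leaves only w = - τ².
E-three-term : ∀ i τ → E (2 ℕ.+ i) τ ≡
  (- (τ * τ) + (- ((+ 2 * + i + + 2) * (+ 2 * + i + + 1)) - (+ 2 * + i + + 3) * (+ 2 * + i + + 2))) * E (suc i) τ
    + - ((+ 2 * + i + + 2) * (+ 2 * + i + + 1) * (+ 2 * + i + + 1) * (+ 2 * + i)) * E i τ
E-three-term i τ = lem (+ i) τ (E i τ) (O i τ)
  where
  lem : ∀ I τ e o →
    let e₁ = - (τ * o) - (+ 2 * I + + 1) * (+ 2 * I) * e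
        J  = + 1 + I
    in - (τ * (τ * e₁ - (+ 2 * I + + 2) * (+ 2 * I + + 1) * o)) - (+ 2 * J + + 1) * (+ 2 * J) * e₁
       ≡ (- (τ * τ) + (- ((+ 2 * I + + 2) * (+ 2 * I + + 1)) - (+ 2 * I + + 3) * (+ 2 * I + + 2))) * e₁
         + - ((+ 2 * I + + 2) * (+ 2 * I + + 1) * (+ 2 * I + + 1) * (+ 2 * I)) * e
  lem = solve-∀

O-three-term : ∀ i τ → O (2 ℕ.+ i) τ ≡
  (- (τ * τ) + (- ((+ 2 * + i + + 3) * (+ 2 * + i + + 2)) - (+ 2 * + i + + 4) * (+ 2 * + i + + 3))) * O (suc i) τ
    + - ((+ 2 * + i + + 3) * (+ 2 * + i + + 2) * (+ 2 * + i + + 2) * (+ 2 * + i + + 1)) * O i τ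
O-three-term i τ = lem (+ i) τ (E (suc i) τ) (O i τ)
  where
  lem : ∀ I τ e o →
    let o₁ = τ * e - (+ 2 * I + + 2) * (+ 2 * I + + 1) * o
        J  = + 1 + I
    in τ * (- (τ * o₁) - (+ 2 * J + + 1) * (+ 2 * J) * e) - (+ 2 * J + + 2) * (+ 2 * J + + 1) * o₁
       ≡ (- (τ * τ) + (- ((+ 2 * I + + 3) * (+ 2 * I + + 2)) - (+ 2 * I + + 4) * (+ 2 * I + + 3))) * o₁
         + - ((+ 2 * I + + 3) * (+ 2 * I + + 2) * (+ 2 * I + + 2) * (+ 2 * I + + 1)) * o
  lem = solve-∀

-- Trapezoidal sums over the range of an entry

up : ℤ → ℕ → List ℤ
up x zero    = x ∷ []
up x (suc d) = x ∷ up (x + + 1) d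

upDiff : ℤ → ℤ → List ℤ
upDiff x (+ d)    = up x d
upDiff x -[1+ _ ] = []

interval : ℤ → ℤ → List ℤ
interval x y = upDiff x (y - x)

-- A gap between equal entries is empty, so that only strictly increasing rows
-- have rows above them.
ranges : ℤ → Range → List ℤ
ranges b (gap x y) = if does (x ℤ.<? y) then interval x y else []
ranges b (end x)   = interval x b

specialIn : Range → ℤ → ℕ
specialIn (gap x y) t = if does (x ℤ.<? t) ∧ does (t ℤ.<? y) then 1 else 0
specialIn (end x)   t = if does (x ℤ.<? t) then 1 else 0

weigh : Range → ℤ → ℤ × ℤ
weigh r t = + (2 ℕ.^ specialIn r t) , t

choices : ℤ → Range → List (ℤ × ℤ)
choices b r = map (weigh r) (ranges b r)

interval-+ : ∀ x d → interval x (x + + d) ≡ up x d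
interval-+ x d = cong (upDiff x) (lem x (+ d))
  where
  lem : ∀ x d → x + d - x ≡ d
  lem = solve-∀

≤⇒+ : ∀ {x y} → x ℤ.≤ y → ∃ λ d → y ≡ x + + d
≤⇒+ {x} {y} x≤y with y - x in eq | ℤ.i≤j⇒0≤j-i x≤y
... | + d | _ = d , trans (lem x y) (cong (λ u → x + u) eq)
  where
  lem : ∀ x y → y ≡ x + (y - x)
  lem = solve-∀

<⇒+ : ∀ {x y} → x ℤ.< y → ∃ λ d → y ≡ x + + suc d
<⇒+ {x} {y} x<y with ≤⇒+ (ℤ.i<j⇒suc[i]≤j x<y)
... | d , refl = d , lem x (+ d)
  where
  lem : ∀ x d → + 1 + x + d ≡ x + (+ 1 + d)
  lem = solve-∀

+-suc-assoc : ∀ x d → x + + suc d ≡ x + + 1 + + d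
+-suc-assoc x d = sym (ℤ.+-assoc x (+ 1) (+ d))

i<i+suc : ∀ x d → x ℤ.< x + + suc d
i<i+suc x d = ℤ.suc[i]≤j⇒i<j (subst (ℤ.suc x ℤ.≤_) (lem x (+ d)) (ℤ.i≤i+j (ℤ.suc x) (+ d)))
  where
  lem : ∀ x d → + 1 + x + d ≡ x + (+ 1 + d)
  lem = solve-∀

specialIn-gap-interior : ∀ {x y t} → x ℤ.< t → t ℤ.< y → specialIn (gap x y) t ≡ 1
specialIn-gap-interior {x} {y} {t} x<t t<y
  rewrite dec-true (x ℤ.<? t) x<t | dec-true (t ℤ.<? y) t<y = refl

specialIn-gap-right : ∀ x y → specialIn (gap x y) y ≡ 0
specialIn-gap-right x y rewrite dec-false (y ℤ.<? y) (ℤ.<-irrefl refl) with does (x ℤ.<? y)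
... | true  = refl
... | false = refl

specialIn-gap-left : ∀ x y → specialIn (gap x y) x ≡ 0
specialIn-gap-left x y rewrite dec-false (x ℤ.<? x) (ℤ.<-irrefl refl) = refl

specialIn-end-interior : ∀ {x t} → x ℤ.< t → specialIn (end x) t ≡ 1
specialIn-end-interior {x} {t} x<t rewrite dec-true (x ℤ.<? t) x<t = refl

specialIn-end-left : ∀ x → specialIn (end x) x ≡ 0
specialIn-end-left x rewrite dec-false (x ℤ.<? x) (ℤ.<-irrefl refl) = refl

weighted-weigh : ∀ r {t} {n} → specialIn r t ≡ n → ∀ ts g →
  weighted (map (weigh r) (t ∷ ts)) g ≡ + (2 ℕ.^ n) * g t + weighted (map (weigh r) ts) g
weighted-weigh r refl ts g = refl

module _ (c : ℤ) (g G : ℤ → ℤ) (step : ∀ t → G (t + + 1) - G t ≡ c * (g t + g (t + + 1))) where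

  private
    -- A start strictly inside the gap has weight 2, whereas a trapezoidal sum begins with weight 1;
    -- the term c * g x is this surplus.
    telescope : ∀ x₀ y d x → x₀ ℤ.< x → y ≡ x + + d →
      c * weighted (map (weigh (gap x₀ y)) (up x d)) g ≡ G y - G x + c * g x
    telescope x₀ y zero    x x₀<x y≡ with trans y≡ (ℤ.+-identityʳ x)
    ... | refl rewrite weighted-weigh (gap x₀ y) (specialIn-gap-right x₀ y) [] g = lem c (g y) (G y)
      where
      lem : ∀ c u v → c * (+ 1 * u + + 0) ≡ v - v + c * u
      lem = solve-∀
    telescope x₀ y (suc d) x x₀<x refl = begin
      c * weighted (map (weigh (gap x₀ y)) (x ∷ up (x + + 1) d)) g
        ≡⟨ cong (c *_) (weighted-weigh (gap x₀ y) (specialIn-gap-interior x₀<x (i<i+suc x d)) (up (x + + 1) d) g) ⟩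
      c * (+ 2 * g x + rest)
        ≡⟨ lem₁ c (g x) rest ⟩
      + 2 * (c * g x) + c * rest
        ≡⟨ cong (λ v → + 2 * (c * g x) + v) (telescope x₀ y d (x + + 1) (ℤ.<-trans x₀<x (i<i+suc x 0)) (+-suc-assoc x d)) ⟩
      + 2 * (c * g x) + (G y - G (x + + 1) + c * g (x + + 1))
        ≡⟨ cancel₁ (- + 1) (lem₂ c (g x) (g (x + + 1)) (G y) (G x) (G (x + + 1))) (step x) ⟩
      G y - G x + c * g x ∎
      where
      open ≡-Reasoning
      rest = weighted (map (weigh (gap x₀ y)) (up (x + + 1) d)) g
      lem₁ : ∀ c u v → c * (+ 2 * u + v) ≡ + 2 * (c * u) + c * v
      lem₁ = solve-∀
      lem₂ : ∀ c u v s t t′ → + 2 * (c * u) + (s - t′ + c * v)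
        ≡ s - t + c * u + - + 1 * ((t′ - t) - c * (u + v))
      lem₂ = solve-∀

  -- The weights 1, 2, ..., 2, 1 make this the sum of g t + g (t + 1) over unit steps, which
  -- telescopes. For x ≡ y the range is empty and the difference is zero too, so the formula extends
  -- to weakly ordered ends.
  gap-sum : ∀ b {x y} → x ℤ.≤ y → c * weighted (choices b (gap x y)) g ≡ G y - G x
  gap-sum b {x} {y} x≤y with x ℤ.<? y
  ... | no  x≮y with ℤ.≤-antisym x≤y (ℤ.≮⇒≥ x≮y)
  ...   | refl = lem c (G x)
    where
    lem : ∀ c u → c * + 0 ≡ u - u
    lem = solve-∀
  gap-sum b {x} {y} x≤y | yes x<y with <⇒+ x<y
  ...   | d , refl rewrite interval-+ x (suc d) = begin
      c * weighted (map (weigh (gap x y)) (x ∷ up (x + + 1) d)) g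
        ≡⟨ cong (c *_) (weighted-weigh (gap x y) (specialIn-gap-left x y) (up (x + + 1) d) g) ⟩
      c * (+ 1 * g x + rest)
        ≡⟨ lem₁ c (g x) rest ⟩
      c * g x + c * rest
        ≡⟨ cong (λ v → c * g x + v) (telescope x y d (x + + 1) (i<i+suc x 0) (+-suc-assoc x d)) ⟩
      c * g x + (G y - G (x + + 1) + c * g (x + + 1))
        ≡⟨ cancel₁ (- + 1) (lem₂ c (g x) (g (x + + 1)) (G y) (G x) (G (x + + 1))) (step x) ⟩
      G y - G x ∎
      where
      open ≡-Reasoning
      rest = weighted (map (weigh (gap x y)) (up (x + + 1) d)) g
      lem₁ : ∀ c u v → c * (+ 1 * u + v) ≡ c * u + c * v
      lem₁ = solve-∀
      lem₂ : ∀ c u v s t t′ → c * u + (s - t′ + c * v)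
        ≡ s - t + - + 1 * ((t′ - t) - c * (u + v))
      lem₂ = solve-∀

module _ (b c : ℤ) (g H : ℤ → ℤ) (step : ∀ t → H t - H (t + + 1) ≡ c * (g t + g (t + + 1)))
  (boundary : H b ≡ c * g b) where

  private
    telescope : ∀ x₀ d x → x₀ ℤ.< x → b ≡ x + + d →
      c * weighted (map (weigh (end x₀)) (up x d)) g ≡ H x + c * g x
    telescope x₀ zero    x x₀<x b≡ with trans b≡ (ℤ.+-identityʳ x)
    ... | refl rewrite weighted-weigh (end x₀) (specialIn-end-interior x₀<x) [] g | boundary = lem c (g b)
      where
      lem : ∀ c u → c * (+ 2 * u + + 0) ≡ c * u + c * u
      lem = solve-∀
    telescope x₀ (suc d) x x₀<x refl = begin
      c * weighted (map (weigh (end x₀)) (x ∷ up (x + + 1) d)) g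
        ≡⟨ cong (c *_) (weighted-weigh (end x₀) (specialIn-end-interior x₀<x) (up (x + + 1) d) g) ⟩
      c * (+ 2 * g x + rest)
        ≡⟨ lem₁ c (g x) rest ⟩
      + 2 * (c * g x) + c * rest
        ≡⟨ cong (λ v → + 2 * (c * g x) + v) (telescope x₀ d (x + + 1) (ℤ.<-trans x₀<x (i<i+suc x 0)) (+-suc-assoc x d)) ⟩
      + 2 * (c * g x) + (H (x + + 1) + c * g (x + + 1))
        ≡⟨ cancel₁ (- + 1) (lem₂ c (g x) (g (x + + 1)) (H x) (H (x + + 1))) (step x) ⟩
      H x + c * g x ∎
      where
      open ≡-Reasoning
      rest = weighted (map (weigh (end x₀)) (up (x + + 1) d)) g
      lem₁ : ∀ c u v → c * (+ 2 * u + v) ≡ + 2 * (c * u) + c * v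
      lem₁ = solve-∀
      lem₂ : ∀ c u v t t′ → + 2 * (c * u) + (t′ + c * v)
        ≡ t + c * u + - + 1 * ((t - t′) - c * (u + v))
      lem₂ = solve-∀

  -- For x below b, the top value b is special and has weight 2. One term c * g b therefore remains
  -- beside the telescoped H x - H b, and `boundary` lets it cancel H b. For x ≡ b the claim is
  -- `boundary` itself.
  end-sum : ∀ {x} → x ℤ.≤ b → c * weighted (choices b (end x)) g ≡ H x
  end-sum {x} x≤b with ≤⇒+ x≤b
  ... | zero  , b≡ with trans b≡ (ℤ.+-identityʳ x)
  ...   | refl rewrite cong (interval x) b≡ | interval-+ x 0
                     | weighted-weigh (end x) (specialIn-end-left x) [] g | boundary = lem c (g x)
    where
    lem : ∀ c u → c * (+ 1 * u + + 0) ≡ c * u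
    lem = solve-∀
  end-sum {x} x≤b | suc d , refl rewrite interval-+ x (suc d) = begin
      c * weighted (map (weigh (end x)) (x ∷ up (x + + 1) d)) g
        ≡⟨ cong (c *_) (weighted-weigh (end x) (specialIn-end-left x) (up (x + + 1) d) g) ⟩
      c * (+ 1 * g x + rest)
        ≡⟨ lem₁ c (g x) rest ⟩
      c * g x + c * rest
        ≡⟨ cong (λ v → c * g x + v) (telescope x d (x + + 1) (i<i+suc x 0) (+-suc-assoc x d)) ⟩
      c * g x + (H (x + + 1) + c * g (x + + 1))
        ≡⟨ cancel₁ (- + 1) (lem₂ c (g x) (g (x + + 1)) (H x) (H (x + + 1))) (step x) ⟩
      H x ∎
      where
      open ≡-Reasoning
      rest = weighted (map (weigh (end x)) (up (x + + 1) d)) g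
      lem₁ : ∀ c u v → c * (+ 1 * u + v) ≡ c * u + c * v
      lem₁ = solve-∀
      lem₂ : ∀ c u v t t′ → c * u + (t′ + c * v)
        ≡ t + - + 1 * ((t - t′) - c * (u + v))
      lem₂ = solve-∀

-- The flag says that the given row has even index, so that the last entry above it has
-- no right neighbour below.
gaps : Bool → List ℤ → List Range
gaps e     []           = []
gaps true  (x ∷ [])     = end x ∷ []
gaps false (x ∷ [])     = []
gaps e     (x ∷ y ∷ ks) = gap x y ∷ gaps e (y ∷ ks)

-- b bounds the last entry only; with weak monotonicity it bounds them all.
data WeaklyIncreasing (b : ℤ) : List ℤ → Set where
  last : ∀ {x} → x ℤ.≤ b → WeaklyIncreasing b (x ∷ [])
  _∷_  : ∀ {x y ks} → x ℤ.≤ y → WeaklyIncreasing b (y ∷ ks) → WeaklyIncreasing b (x ∷ y ∷ ks)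

-- Summing out one row of a determinant

τ : ℤ → ℤ → ℤ
τ b x = + 2 * b + + 1 - + 2 * x

τ-suc : ∀ b x → τ b (x + + 1) ≡ τ b x - + 2
τ-suc = lem
  where
  lem : ∀ b x → + 2 * b + + 1 - + 2 * (x + + 1) ≡ + 2 * b + + 1 - + 2 * x - + 2
  lem = solve-∀

τ-self : ∀ b → τ b b ≡ + 1
τ-self = lem
  where
  lem : ∀ b → + 2 * b + + 1 - + 2 * b ≡ + 1
  lem = solve-∀

module _ (b : ℤ) where

  private
    Eb Ob : ℕ → ℤ → ℤ
    Eb i x = E i (τ b x)
    Ob i x = O i (τ b x)

  IsGap IsRange : Range → Set
  IsGap (gap x y) = x ℤ.≤ y
  IsGap (end x)   = ⊥
  IsRange (gap x y) = x ℤ.≤ y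
  IsRange (end x)   = x ℤ.≤ b

  gaps-IsGap : ∀ {ks} → WeaklyIncreasing b ks → All IsGap (gaps false ks)
  gaps-IsGap (last _)   = []
  gaps-IsGap (x≤y ∷ ks) = x≤y ∷ gaps-IsGap ks

  gaps-IsRange : ∀ {ks} → WeaklyIncreasing b ks → All IsRange (gaps true ks)
  gaps-IsRange (last x≤b) = x≤b ∷ []
  gaps-IsRange (x≤y ∷ ks) = x≤y ∷ gaps-IsRange ks

  -- The signed endpoints that replace a range after telescoping. The orientations differ because
  -- the antiderivative is `E` at the right end minus the left for sums of `O`, but `O` at the left
  -- end minus the right for sums of `E`.
  rise fall : Range → List (ℤ × ℤ)
  rise (gap x y) = (+ 1 , y) ∷ (- + 1 , x) ∷ []
  rise (end x)   = []
  fall (gap x y) = (+ 1 , x) ∷ (- + 1 , y) ∷ []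
  fall (end x)   = (+ 1 , x) ∷ []

  choices-rise : ∀ i r → IsGap r → oddC i * weighted (choices b r) (Ob i) ≡ weighted (rise r) (Eb (suc i))
  choices-rise i (gap x y) x≤y =
    trans (gap-sum (oddC i) (Ob i) (Eb (suc i)) step b x≤y) (lem (Eb (suc i) y) (Eb (suc i) x))
    where
    lem : ∀ u v → u - v ≡ + 1 * u + (- + 1 * v + + 0)
    lem = solve-∀
    step : ∀ t → Eb (suc i) (t + + 1) - Eb (suc i) t ≡ oddC i * (Ob i t + Ob i (t + + 1))
    step t rewrite τ-suc b t = E-step i (τ b t)

  choices-fall : ∀ i r → IsRange r → evenC i * weighted (choices b r) (Eb i) ≡ weighted (fall r) (Ob i)
  choices-fall i (gap x y) x≤y = trans
    (gap-sum (evenC i) (Eb i) (λ t → - Ob i t) step b x≤y) (lem (Ob i x) (Ob i y))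
    where
    lem : ∀ u v → - v - - u ≡ + 1 * u + (- + 1 * v + + 0)
    lem = solve-∀
    lem₂ : ∀ u v → - u - - v ≡ v - u
    lem₂ = solve-∀
    step : ∀ t → - Ob i (t + + 1) - - Ob i t ≡ evenC i * (Eb i t + Eb i (t + + 1))
    step t = trans (lem₂ (Ob i (t + + 1)) (Ob i t))
      (subst (λ s → Ob i t - O i s ≡ evenC i * (Eb i t + E i s)) (sym (τ-suc b t)) (O-step i (τ b t)))
  choices-fall i (end x) x≤b = trans
    (end-sum b (evenC i) (Eb i) (Ob i) step boundary x≤b) (lem (Ob i x))
    where
    lem : ∀ u → u ≡ + 1 * u + + 0
    lem = solve-∀
    step : ∀ t → Ob i t - Ob i (t + + 1) ≡ evenC i * (Eb i t + Eb i (t + + 1))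
    step t rewrite τ-suc b t = O-step i (τ b t)
    boundary : Ob i b ≡ evenC i * Eb i b
    boundary rewrite τ-self b = O-one i

  -- Each gap picks one of its ends. If some gap picks its right end and the next one its left end,
  -- an entry is repeated and `H` vanishes. The survivors pick left ends up to some point and right
  -- ends from there on, so they omit exactly one entry: this is an expansion along a row of ones.
  sumOver-rise : ∀ (H : List ℤ → ℤ) → Alternating H → ∀ x ks →
    sumOver rise (gaps false (x ∷ ks)) H ≡ wedge (λ _ → + 1) H (x ∷ ks)
  sumOver-rise H alt x []       = lem (H [])
    where
    lem : ∀ u → u ≡ + 1 * u - + 0
    lem = solve-∀
  sumOver-rise H alt x (y ∷ ks) = begin
    + 1 * sumOver rise (gaps false (y ∷ ks)) (H ∘ (y ∷_)) + (- + 1 * sumOver rise (gaps false (y ∷ ks)) (H ∘ (x ∷_)) + + 0)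
      ≡⟨ cong₂ (λ u v → + 1 * u + (- + 1 * v + + 0))
           (sumOver-rise (H ∘ (y ∷_)) (alternating-∷ {ω = H} alt y) y ks)
           (sumOver-rise (H ∘ (x ∷_)) (alternating-∷ {ω = H} alt x) y ks) ⟩
    + 1 * (+ 1 * H (y ∷ ks) - wedge (λ _ → + 1) (λ zs → H (y ∷ y ∷ zs)) ks) + (- + 1 * wedge (λ _ → + 1) (H ∘ (x ∷_)) (y ∷ ks) + + 0)
      ≡⟨ cong (λ u → + 1 * (+ 1 * H (y ∷ ks) - u) + (- + 1 * wedge (λ _ → + 1) (H ∘ (x ∷_)) (y ∷ ks) + + 0))
           (trans (wedge-congʳ _ (alt [] y) ks) (wedge-zeroʳ _ ks)) ⟩
    + 1 * (+ 1 * H (y ∷ ks) - + 0) + (- + 1 * wedge (λ _ → + 1) (H ∘ (x ∷_)) (y ∷ ks) + + 0)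
      ≡⟨ lem (H (y ∷ ks)) (wedge (λ _ → + 1) (H ∘ (x ∷_)) (y ∷ ks)) ⟩
    + 1 * H (y ∷ ks) - wedge (λ _ → + 1) (H ∘ (x ∷_)) (y ∷ ks) ∎
    where
    open ≡-Reasoning
    lem : ∀ u v → + 1 * (+ 1 * u - + 0) + (- + 1 * v + + 0) ≡ + 1 * u - v
    lem = solve-∀

  -- The last range forces its only end, so a right end picked anywhere leads to a repetition
  -- further on; only the choice of all left ends survives.
  sumOver-fall : ∀ (H : List ℤ → ℤ) → Alternating H → ∀ x ks →
    sumOver fall (gaps true (x ∷ ks)) H ≡ H (x ∷ ks)
  sumOver-fall H alt x []       = lem (H (x ∷ []))
    where
    lem : ∀ u → + 1 * u + + 0 ≡ u
    lem = solve-∀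
  sumOver-fall H alt x (y ∷ ks) = begin
    + 1 * sumOver fall (gaps true (y ∷ ks)) (H ∘ (x ∷_)) + (- + 1 * sumOver fall (gaps true (y ∷ ks)) (H ∘ (y ∷_)) + + 0)
      ≡⟨ cong₂ (λ u v → + 1 * u + (- + 1 * v + + 0))
           (sumOver-fall (H ∘ (x ∷_)) (alternating-∷ {ω = H} alt x) y ks)
           (trans (sumOver-fall (H ∘ (y ∷_)) (alternating-∷ {ω = H} alt y) y ks) (alt [] y ks)) ⟩
    + 1 * H (x ∷ y ∷ ks) + + 0
      ≡⟨ lem (H (x ∷ y ∷ ks)) ⟩
    H (x ∷ y ∷ ks) ∎
    where
    open ≡-Reasoning
    lem : ∀ u → + 1 * u + + 0 ≡ u
    lem = solve-∀

  -- Summation turns the rows `O i` into the rows `E (suc i)`. The row of ones from `sumOver-rise`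
  -- is `E 0`, the missing first row of the larger determinant.
  odd-step : ∀ m {ks} → WeaklyIncreasing b ks →
    ∏ₙ oddC 0 m * sumOver (choices b) (gaps false ks) (det Ob 0 m) ≡ det Eb 0 (suc m) ks
  odd-step m {x ∷ ks} inc = begin
    ∏ₙ oddC 0 m * sumOver (choices b) rs (det Ob 0 m)
      ≡⟨ cong (∏ₙ oddC 0 m *_) (sumOver-det (choices b) Ob 0 m rs) ⟩
    ∏ₙ oddC 0 m * det (λ i r → weighted (choices b r) (Ob i)) 0 m rs
      ≡⟨ det-scale-All IsGap oddC choices-rise 0 m rs (gaps-IsGap inc) ⟩
    det (λ i r → weighted (rise r) (Eb (suc i))) 0 m rs
      ≡⟨ sumOver-det rise (Eb ∘ suc) 0 m rs ⟨
    sumOver rise rs (det (Eb ∘ suc) 0 m)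
      ≡⟨ sumOver-cong rise rs (det-shift Eb 0 m) ⟩
    sumOver rise rs (det Eb 1 m)
      ≡⟨ sumOver-rise (det Eb 1 m) (det-alternating Eb 1 m) x ks ⟩
    det Eb 0 (suc m) (x ∷ ks) ∎
    where
    open ≡-Reasoning
    rs = gaps false (x ∷ ks)

  even-step : ∀ m {ks} → WeaklyIncreasing b ks →
    ∏ₙ evenC 0 m * sumOver (choices b) (gaps true ks) (det Eb 0 m) ≡ det Ob 0 m ks
  even-step m {x ∷ ks} inc = begin
    ∏ₙ evenC 0 m * sumOver (choices b) rs (det Eb 0 m)
      ≡⟨ cong (∏ₙ evenC 0 m *_) (sumOver-det (choices b) Eb 0 m rs) ⟩
    ∏ₙ evenC 0 m * det (λ i r → weighted (choices b r) (Eb i)) 0 m rs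
      ≡⟨ det-scale-All IsRange evenC choices-fall 0 m rs (gaps-IsRange inc) ⟩
    det (λ i r → weighted (fall r) (Ob i)) 0 m rs
      ≡⟨ sumOver-det fall Ob 0 m rs ⟨
    sumOver fall rs (det Ob 0 m)
      ≡⟨ sumOver-fall (det Ob 0 m) (det-alternating Ob 0 m) x ks ⟩
    det Ob 0 m (x ∷ ks) ∎
    where
    open ≡-Reasoning
    rs = gaps true (x ∷ ks)

-- Interlacing as a relation and as an enumeration

-- Interlacing rows

∈-up⁻ : ∀ d {x t} → t ∈ up x d → x ℤ.≤ t × t ℤ.≤ x + + d
∈-up⁻ zero    {x} (here refl) = ℤ.≤-refl , ℤ.≤-reflexive (sym (ℤ.+-identityʳ x))
∈-up⁻ (suc d) {x} (here refl) = ℤ.≤-refl , ℤ.<⇒≤ (i<i+suc x d)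
∈-up⁻ (suc d) {x} {t} (there t∈) with ∈-up⁻ d t∈
... | l , u = ℤ.≤-trans (ℤ.<⇒≤ (i<i+suc x 0)) l , subst (t ℤ.≤_) (sym (+-suc-assoc x d)) u

∈-up⁺ : ∀ d e x → e ℕ.≤ d → x + + e ∈ up x d
∈-up⁺ zero    zero    x _         = here (ℤ.+-identityʳ x)
∈-up⁺ (suc d) zero    x _         = here (ℤ.+-identityʳ x)
∈-up⁺ (suc d) (suc e) x (s≤s e≤d) =
  there (subst (_∈ up (x + + 1) d) (sym (+-suc-assoc x e)) (∈-up⁺ d e (x + + 1) e≤d))

up-unique : ∀ d x → Unique (up x d)
up-unique zero    x = [] ∷ []
up-unique (suc d) x = All.tabulate fresh ∷ up-unique d (x + + 1)
  where
  fresh : ∀ {t} → t ∈ up (x + + 1) d → x ≢ t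
  fresh t∈ refl = ℤ.<-irrefl refl (ℤ.<-≤-trans (i<i+suc x 0) (proj₁ (∈-up⁻ d t∈)))

upDiff-unique : ∀ x d → Unique (upDiff x d)
upDiff-unique x (+ d)    = up-unique d x
upDiff-unique x -[1+ _ ] = []

∈-interval⁻ : ∀ {x y t} → t ∈ interval x y → x ℤ.≤ t × t ℤ.≤ y
∈-interval⁻ {x} {y} {t} t∈ with y - x in eq
... | + d with ∈-up⁻ d t∈
...   | l , u = l , subst (t ℤ.≤_) (trans (cong (λ v → x + v) (sym eq)) (lem x y)) u
  where
  lem : ∀ x y → x + (y - x) ≡ y
  lem = solve-∀

∈-interval⁺ : ∀ {x y t} → x ℤ.≤ t → t ℤ.≤ y → t ∈ interval x y
∈-interval⁺ {x} x≤t t≤y with ≤⇒+ x≤t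
... | e , refl with ≤⇒+ t≤y
...   | f , refl = subst (λ l → x + + e ∈ l)
          (sym (trans (cong (interval x) (ℤ.+-assoc x (+ e) (+ f))) (interval-+ x (e ℕ.+ f))))
          (∈-up⁺ (e ℕ.+ f) e x (ℕ.m≤m+n e f))

ranges-unique : ∀ b r → Unique (ranges b r)
ranges-unique b (gap x y) with does (x ℤ.<? y)
... | true  = upDiff-unique x (y - x)
... | false = []
ranges-unique b (end x) = upDiff-unique x (b - x)

∈-gap⁻ : ∀ b {x y t} → t ∈ ranges b (gap x y) → x ℤ.< y × x ℤ.≤ t × t ℤ.≤ y
∈-gap⁻ b {x} {y} t∈ with x ℤ.<? y
... | yes x<y = x<y , ∈-interval⁻ t∈

∈-gap⁺ : ∀ b {x y t} → x ℤ.< y → x ℤ.≤ t → t ℤ.≤ y → t ∈ ranges b (gap x y)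
∈-gap⁺ b {x} {y} x<y x≤t t≤y rewrite dec-true (x ℤ.<? y) x<y = ∈-interval⁺ x≤t t≤y

choose : ℤ → List Range → List (List ℤ)
choose b []       = [] ∷ []
choose b (r ∷ rs) = cartesianProductWith _∷_ (ranges b r) (choose b rs)

choose-unique : ∀ b rs → Unique (choose b rs)
choose-unique b []       = [] ∷ []
choose-unique b (r ∷ rs) =
  Unique.cartesianProductWith⁺ _∷_ List.∷-injective (ranges-unique b r) (choose-unique b rs)

-- The upper row comes first. Strictness is recorded for the lower row only; that of the upper row
-- is recorded when it becomes the lower row of the next pair.
data Interlaced (b : ℤ) : Bool → List ℤ → List ℤ → Set where
  end  : ∀ {x t} → x ℤ.≤ t → t ℤ.≤ b → Interlaced b true (t ∷ []) (x ∷ [])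
  none : ∀ {x} → Interlaced b false [] (x ∷ [])
  cons : ∀ {e x y t ls ks} → x ℤ.< y → x ℤ.≤ t → t ℤ.≤ y →
    Interlaced b e ls (y ∷ ks) → Interlaced b e (t ∷ ls) (x ∷ y ∷ ks)

module _ {b : ℤ} where

  ∈-choose⁻ : ∀ e x ks {ls} → ls ∈ choose b (gaps e (x ∷ ks)) → Interlaced b e ls (x ∷ ks)
  ∈-choose⁻ true  x [] ls∈ with ∈-cartesianProductWith⁻ _∷_ (ranges b (end x)) ([] ∷ []) ls∈
  ... | t , _ , t∈ , here refl , refl with ∈-interval⁻ t∈
  ...   | x≤t , t≤b = end x≤t t≤b
  ∈-choose⁻ false x [] (here refl) = none
  ∈-choose⁻ true  x (y ∷ ks) ls∈
    with ∈-cartesianProductWith⁻ _∷_ (ranges b (gap x y)) (choose b (gaps true (y ∷ ks))) ls∈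
  ... | t , ts , t∈ , ts∈ , refl with ∈-gap⁻ b t∈
  ...   | x<y , x≤t , t≤y = cons x<y x≤t t≤y (∈-choose⁻ true y ks ts∈)
  ∈-choose⁻ false x (y ∷ ks) ls∈
    with ∈-cartesianProductWith⁻ _∷_ (ranges b (gap x y)) (choose b (gaps false (y ∷ ks))) ls∈
  ... | t , ts , t∈ , ts∈ , refl with ∈-gap⁻ b t∈
  ...   | x<y , x≤t , t≤y = cons x<y x≤t t≤y (∈-choose⁻ false y ks ts∈)

  ∈-choose⁺ : ∀ {e ls ks} → Interlaced b e ls ks → ls ∈ choose b (gaps e ks)
  ∈-choose⁺ (end x≤t t≤b) = ∈-cartesianProductWith⁺ _∷_ (∈-interval⁺ x≤t t≤b) (here refl)
  ∈-choose⁺ none          = here refl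
  ∈-choose⁺ {true}  (cons x<y x≤t t≤y il) = ∈-cartesianProductWith⁺ _∷_ (∈-gap⁺ b x<y x≤t t≤y) (∈-choose⁺ il)
  ∈-choose⁺ {false} (cons x<y x≤t t≤y il) = ∈-cartesianProductWith⁺ _∷_ (∈-gap⁺ b x<y x≤t t≤y) (∈-choose⁺ il)

  Interlaced-length : ∀ {e ls ks} → Interlaced b e ls ks →
    length ks ≡ (if e then length ls else suc (length ls))
  Interlaced-length (end _ _) = refl
  Interlaced-length none      = refl
  Interlaced-length {true}  (cons _ _ _ il) = cong suc (Interlaced-length il)
  Interlaced-length {false} (cons _ _ _ il) = cong suc (Interlaced-length il)

  Interlaced-increasing : ∀ {e ls ks} → Interlaced b e ls ks →
    ∀ j {x y} → ks ‼ j ≡ just x → ks ‼ suc j ≡ just y → x ℤ.< y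
  Interlaced-increasing (cons x<y _ _ _)  zero    refl refl = x<y
  Interlaced-increasing (cons _ _ _ il)   (suc j) p    q    = Interlaced-increasing il j p q

  Interlaced-left : ∀ {e ls ks} → Interlaced b e ls ks →
    ∀ j {x y} → ls ‼ j ≡ just x → ks ‼ j ≡ just y → y ℤ.≤ x
  Interlaced-left (end x≤t _)        zero    refl refl = x≤t
  Interlaced-left (cons _ x≤t _ _)   zero    refl refl = x≤t
  Interlaced-left (cons _ _ _ il)    (suc j) p    q    = Interlaced-left il j p q

  Interlaced-right : ∀ {e ls ks} → Interlaced b e ls ks →
    ∀ j {x y} → ls ‼ j ≡ just x → ks ‼ suc j ≡ just y → x ℤ.≤ y
  Interlaced-right (cons _ _ t≤y _)   zero    refl refl = t≤y
  Interlaced-right (cons _ _ _ il)    (suc j) p    q    = Interlaced-right il j p q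

  Interlaced-intro : ∀ e ls k ks → length (k ∷ ks) ≡ (if e then length ls else suc (length ls)) →
    (∀ j {x y} → (k ∷ ks) ‼ j ≡ just x → (k ∷ ks) ‼ suc j ≡ just y → x ℤ.< y) →
    (∀ j {x y} → ls ‼ j ≡ just x → (k ∷ ks) ‼ j ≡ just y → y ℤ.≤ x) →
    (∀ j {x y} → ls ‼ j ≡ just x → (k ∷ ks) ‼ suc j ≡ just y → x ℤ.≤ y) →
    (∀ j {x} → ls ‼ j ≡ just x → x ℤ.≤ b) →
    Interlaced b e ls (k ∷ ks)
  Interlaced-intro true  (t ∷ [])     k []       len inc lft rgt bnd = end (lft 0 refl refl) (bnd 0 refl)
  Interlaced-intro false []           k []       len inc lft rgt bnd = none
  Interlaced-intro true  (t ∷ ls)     k (y ∷ ks) len inc lft rgt bnd =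
    cons (inc 0 refl refl) (lft 0 refl refl) (rgt 0 refl refl)
      (Interlaced-intro true ls y ks (ℕ.suc-injective len) (inc ∘ suc) (lft ∘ suc) (rgt ∘ suc) (bnd ∘ suc))
  Interlaced-intro false (t ∷ ls)     k (y ∷ ks) len inc lft rgt bnd =
    cons (inc 0 refl refl) (lft 0 refl refl) (rgt 0 refl refl)
      (Interlaced-intro false ls y ks (ℕ.suc-injective len) (inc ∘ suc) (lft ∘ suc) (rgt ∘ suc) (bnd ∘ suc))

  WeaklyIncreasing-bounded : ∀ {ks} → WeaklyIncreasing b ks → ∀ j {x} → ks ‼ j ≡ just x → x ℤ.≤ b
  WeaklyIncreasing-bounded (last x≤b)     zero    refl = x≤b
  WeaklyIncreasing-bounded (x≤y ∷ inc)    zero    refl = ℤ.≤-trans x≤y (WeaklyIncreasing-bounded inc 0 refl)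
  WeaklyIncreasing-bounded (x≤y ∷ inc)    (suc j) p    = WeaklyIncreasing-bounded inc j p

  -- An entry y of the lower row separates t from its right neighbour; where there is no neighbour,
  -- y still bounds t and lies below b.
  Interlaced-WeaklyIncreasing : ∀ {e t ls ks} → Interlaced b e (t ∷ ls) ks →
    WeaklyIncreasing b ks → WeaklyIncreasing b (t ∷ ls)
  Interlaced-WeaklyIncreasing (end _ t≤b) _ = last t≤b
  Interlaced-WeaklyIncreasing {ls = []}     (cons _ _ t≤y _)  (_ ∷ inc) =
    last (ℤ.≤-trans t≤y (WeaklyIncreasing-bounded inc 0 refl))
  Interlaced-WeaklyIncreasing {ls = s ∷ ls} (cons _ _ t≤y il) (_ ∷ inc) =
    ℤ.≤-trans t≤y (Interlaced-left il 0 refl refl) ∷ Interlaced-WeaklyIncreasing il inc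

-- Enumeration of the triangles

module _ {A : Set} where

  ‼-< : ∀ (xs : List A) i {x} → xs ‼ i ≡ just x → i ℕ.< length xs
  ‼-< (_ ∷ xs) zero    _ = s≤s z≤n
  ‼-< (_ ∷ xs) (suc i) p = s≤s (‼-< xs i p)

  ‼-just : ∀ (xs : List A) i → i ℕ.< length xs → ∃ λ x → xs ‼ i ≡ just x
  ‼-just (x ∷ xs) zero    _         = x , refl
  ‼-just (x ∷ xs) (suc i) (s≤s i<n) = ‼-just xs i i<n

  ‼-∷ʳ-init : ∀ (xs : List A) y i {x} → xs ‼ i ≡ just x → (xs ∷ʳ y) ‼ i ≡ just x
  ‼-∷ʳ-init (_ ∷ xs) y zero    p = p
  ‼-∷ʳ-init (_ ∷ xs) y (suc i) p = ‼-∷ʳ-init xs y i p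

  ‼-∷ʳ-last : ∀ (xs : List A) y → (xs ∷ʳ y) ‼ length xs ≡ just y
  ‼-∷ʳ-last []       y = refl
  ‼-∷ʳ-last (_ ∷ xs) y = ‼-∷ʳ-last xs y

  ‼-∷ʳ⁻ : ∀ (xs : List A) y i {x} → (xs ∷ʳ y) ‼ i ≡ just x →
    xs ‼ i ≡ just x ⊎ (i ≡ length xs × y ≡ x)
  ‼-∷ʳ⁻ []       y zero    p = inj₂ (refl , just-injective p)
  ‼-∷ʳ⁻ (_ ∷ xs) y zero    p = inj₁ p
  ‼-∷ʳ⁻ (_ ∷ xs) y (suc i) p with ‼-∷ʳ⁻ xs y i p
  ... | inj₁ q         = inj₁ q
  ... | inj₂ (q , y≡x) = inj₂ (cong suc q , y≡x)

row-init : ∀ T k i {r} → row T i ≡ just r → row (T ∷ʳ k) i ≡ just r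
row-init T k (suc i) p = ‼-∷ʳ-init T k i p

row-last : ∀ T k → row (T ∷ʳ k) (suc (length T)) ≡ just k
row-last T k = ‼-∷ʳ-last T k

row⁻ : ∀ T k i {r} → row (T ∷ʳ k) i ≡ just r → row T i ≡ just r ⊎ (i ≡ suc (length T) × k ≡ r)
row⁻ T k (suc i) p with ‼-∷ʳ⁻ T k i p
... | inj₁ q         = inj₁ q
... | inj₂ (q , k≡r) = inj₂ (cong suc q , k≡r)

row-≤ : ∀ T i {r} → row T i ≡ just r → i ℕ.≤ length T
row-≤ T (suc i) p = ‼-< T i p

ent⁻ : ∀ T i j {x} → ent T i j ≡ just x →
  ∃ λ r → ∃ λ j′ → row T i ≡ just r × j ≡ suc j′ × r ‼ j′ ≡ just x
ent⁻ T i (suc j) p with row T i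
... | just r = r , j , refl , refl , p

ent⁺ : ∀ T i j {r x} → row T i ≡ just r → r ‼ j ≡ just x → ent T i (suc j) ≡ just x
ent⁺ T i j p q rewrite p = q

ent-init : ∀ T k i j {x} → ent T i j ≡ just x → ent (T ∷ʳ k) i j ≡ just x
ent-init T k i j p with ent⁻ T i j p
... | r , j′ , q , refl , q′ = ent⁺ (T ∷ʳ k) i j′ (row-init T k i q) q′

ent-∷ʳ⁻ : ∀ T k i j {x} → ent (T ∷ʳ k) i j ≡ just x →
  ent T i j ≡ just x × i ℕ.≤ length T ⊎ (i ≡ suc (length T) × ∃ λ j′ → j ≡ suc j′ × k ‼ j′ ≡ just x)
ent-∷ʳ⁻ T k i j p with ent⁻ (T ∷ʳ k) i j p
... | r , j′ , q , refl , q′ with row⁻ T k i q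
...   | inj₁ q″          = inj₁ (ent⁺ T i j′ q″ q′ , row-≤ T i q″)
...   | inj₂ (i≡ , refl) = inj₂ (i≡ , j′ , refl , q′)

length-∷ʳ : ∀ {A : Set} (xs : List A) y → length (xs ∷ʳ y) ≡ suc (length xs)
length-∷ʳ []       y = refl
length-∷ʳ (_ ∷ xs) y = cong suc (length-∷ʳ xs y)

IsHMT-init : ∀ {n T k} → IsHMT (suc n) (T ∷ʳ k) → IsHMT n T
IsHMT-init {n} {T} {k} h = record
  { order  = ℕ.suc-injective (trans (sym (length-∷ʳ T k)) order)
  ; shape  = λ i r p → shape i r (row-init T k i p)
  ; rowInc = λ i j x y p q → rowInc i j x y (ent-init T k i j p) (ent-init T k i (suc j) q)
  ; downL  = λ i j x y p q → downL i j x y (ent-init T k i j p) (ent-init T k (suc i) j q)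
  ; downR  = λ i j x y p q → downR i j x y (ent-init T k i j p) (ent-init T k (suc i) (suc j) q)
  }
  where open IsHMT h

IsHMT-∷ʳ : ∀ {b e n T l k} → IsHMT n T → row T n ≡ just l → length k ≡ ⌈ suc n /2⌉ →
  Interlaced b e l k → IsHMT (suc n) (T ∷ʳ k)
IsHMT-∷ʳ {n = n} {T} {l} {k} h bottom len il with IsHMT.order h
... | refl = record
  { order  = length-∷ʳ T k
  ; shape  = shape′
  ; rowInc = rowInc′
  ; downL  = downL′
  ; downR  = downR′
  }
  where
  open IsHMT h
  shape′ : ∀ i r → row (T ∷ʳ k) i ≡ just r → length r ≡ ⌈ i /2⌉
  shape′ i r p with row⁻ T k i p
  ... | inj₁ q             = shape i r q
  ... | inj₂ (refl , refl) = len
  rowInc′ : ∀ i j x y → ent (T ∷ʳ k) i j ≡ just x → ent (T ∷ʳ k) i (suc j) ≡ just y → x ℤ.< y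
  rowInc′ i j x y p q with ent-∷ʳ⁻ T k i j p | ent-∷ʳ⁻ T k i (suc j) q
  ... | inj₁ (p′ , _) | inj₁ (q′ , _) = rowInc i j x y p′ q′
  ... | inj₁ (_ , i≤) | inj₂ (refl , _) = contradiction i≤ ℕ.1+n≰n
  ... | inj₂ (refl , _) | inj₁ (_ , i≤) = contradiction i≤ ℕ.1+n≰n
  ... | inj₂ (refl , j′ , refl , p′) | inj₂ (_ , _ , refl , q′) = Interlaced-increasing il j′ p′ q′
  bottomEnt : ∀ j {x} → ent T n (suc j) ≡ just x → l ‼ j ≡ just x
  bottomEnt j p rewrite bottom = p
  downL′ : ∀ i j x y → ent (T ∷ʳ k) i j ≡ just x → ent (T ∷ʳ k) (suc i) j ≡ just y → y ℤ.≤ x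
  downL′ i j x y p q with ent-∷ʳ⁻ T k i j p | ent-∷ʳ⁻ T k (suc i) j q
  ... | inj₁ (p′ , _) | inj₁ (q′ , _) = downL i j x y p′ q′
  ... | inj₁ (p′ , _) | inj₂ (refl , j′ , refl , q′) = Interlaced-left il j′ (bottomEnt j′ p′) q′
  ... | inj₂ (refl , _) | inj₁ (_ , i≤) = contradiction (ℕ.<⇒≤ i≤) ℕ.1+n≰n
  ... | inj₂ (refl , _) | inj₂ (i≡ , _) = contradiction i≡ ℕ.1+n≢n
  downR′ : ∀ i j x y → ent (T ∷ʳ k) i j ≡ just x → ent (T ∷ʳ k) (suc i) (suc j) ≡ just y → x ℤ.≤ y
  downR′ i j x y p q with ent-∷ʳ⁻ T k i j p | ent-∷ʳ⁻ T k (suc i) (suc j) q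
  ... | inj₁ (p′ , _) | inj₁ (q′ , _) = downR i j x y p′ q′
  downR′ i (suc j) x y p q | inj₁ (p′ , _) | inj₂ (refl , _ , refl , q′) =
    Interlaced-right il j (bottomEnt j p′) q′
  ... | inj₂ (refl , _) | inj₁ (_ , i≤) = contradiction (ℕ.<⇒≤ i≤) ℕ.1+n≰n
  ... | inj₂ (refl , _) | inj₂ (i≡ , _) = contradiction i≡ ℕ.1+n≢n

even : ℕ → Bool
even zero    = true
even (suc n) = not (even n)

half-suc : ∀ n → ⌊ suc n /2⌋ ≡ (if even n then ⌊ n /2⌋ else suc ⌊ n /2⌋)
half-suc zero          = refl
half-suc (suc zero)    = refl
half-suc (suc (suc n)) with even n | half-suc n
... | true  | eq = cong suc eq
... | false | eq = cong suc eq

⌈/2⌉-suc : ∀ n → ⌈ 2 ℕ.+ n /2⌉ ≡ (if even n then ⌈ suc n /2⌉ else suc ⌈ suc n /2⌉)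
⌈/2⌉-suc n with even n | half-suc n
... | true  | eq = cong suc eq
... | false | eq = cong suc eq

length-above : ∀ {b} n {ls ks} → Interlaced b (even n) ls ks →
  length ks ≡ ⌈ 2 ℕ.+ n /2⌉ → length ls ≡ ⌈ suc n /2⌉
length-above n il len with even n | ⌈/2⌉-suc n | Interlaced-length il
... | true  | eq | lk = trans (sym lk) (trans len eq)
... | false | eq | lk = ℕ.suc-injective (trans (sym lk) (trans len eq))

-- The order is suc n; the row 2 + n below the last row of such a triangle is even when n is.
triangles : ℤ → ℕ → List ℤ → List Triangle
triangles b zero    k = (k ∷ []) ∷ []
triangles b (suc n) k = concatMap (λ l → map (_∷ʳ k) (triangles b n l)) (choose b (gaps (even n) k))

module _ (b : ℤ) where

  HMT : ℕ → List ℤ → Triangle → Set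
  HMT n k T = IsHMT n T × BottomRow n T k × BoundedBy b T

  ∈-triangles-suc⁻ : ∀ n k {T} → T ∈ triangles b (suc n) k →
    ∃ λ l → ∃ λ T′ → l ∈ choose b (gaps (even n) k) × T′ ∈ triangles b n l × T ≡ T′ ∷ʳ k
  ∈-triangles-suc⁻ n k T∈ with find (∈-concatMap⁻ (λ l → map (_∷ʳ k) (triangles b n l)) T∈)
  ... | l , l∈ , T∈′ with ∈-map⁻ (_∷ʳ k) T∈′
  ...   | T′ , T′∈ , eq = l , T′ , l∈ , T′∈ , eq

  triangles-sound : ∀ n k → length k ≡ ⌈ suc n /2⌉ → WeaklyIncreasing b k →
    ∀ {T} → T ∈ triangles b n k → HMT (suc n) k T
  triangles-sound zero    (x ∷ []) len (last x≤b) (here refl) =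
    record { order = refl ; shape = shape′ ; rowInc = rowInc′ ; downL = downL′ ; downR = downR′ } , refl , bounded
    where
    T : Triangle
    T = (x ∷ []) ∷ []
    shape′ : ∀ i r → row T i ≡ just r → length r ≡ ⌈ i /2⌉
    shape′ (suc zero) _ refl = refl
    rowInc′ : ∀ i j u v → ent T i j ≡ just u → ent T i (suc j) ≡ just v → u ℤ.< v
    rowInc′ (suc zero) (suc zero)    u v p ()
    rowInc′ (suc zero) (suc (suc j)) u v () q
    downL′ : ∀ i j u v → ent T i j ≡ just u → ent T (suc i) j ≡ just v → v ℤ.≤ u
    downL′ zero    (suc j) u v () q
    downL′ (suc i) (suc j) u v p  ()
    downR′ : ∀ i j u v → ent T i j ≡ just u → ent T (suc i) (suc j) ≡ just v → u ℤ.≤ v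
    downR′ zero    (suc j) u v () q
    downR′ (suc i) j u v p ()
    bounded : BoundedBy b T
    bounded (suc zero) (suc zero) _ refl = x≤b
  triangles-sound (suc n) (x ∷ ks) len inc T∈ with ∈-triangles-suc⁻ n (x ∷ ks) T∈
  ... | [] , T′ , l∈ , T′∈ , refl = contradiction (length-above n (∈-choose⁻ (even n) x ks l∈) len) λ ()
  ... | t ∷ ls , T′ , l∈ , T′∈ , refl with ∈-choose⁻ (even n) x ks l∈
  ...   | il with triangles-sound n (t ∷ ls) (length-above n il len) (Interlaced-WeaklyIncreasing il inc) T′∈
  ...     | h , bottom , bounded = IsHMT-∷ʳ h bottom len il , bottom′ , bounded′
    where
    bottom′ : row (T′ ∷ʳ (x ∷ ks)) (2 ℕ.+ n) ≡ just (x ∷ ks)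
    bottom′ = subst (λ m → row (T′ ∷ʳ (x ∷ ks)) (suc m) ≡ just (x ∷ ks)) (IsHMT.order h) (row-last T′ (x ∷ ks))
    bounded′ : BoundedBy b (T′ ∷ʳ (x ∷ ks))
    bounded′ i j y p with ent-∷ʳ⁻ T′ (x ∷ ks) i j p
    ... | inj₁ (q , _)             = bounded i j y q
    ... | inj₂ (_ , j′ , refl , q) = WeaklyIncreasing-bounded inc j′ q

  -- Splitting off the last row, which the bottom condition identifies with `k`, leaves a smaller
  -- triangle; the order conditions between the last two rows are what `Interlaced-intro` asks for.
  triangles-complete : ∀ n k {T} → HMT (suc n) k T → T ∈ triangles b n k
  triangles-complete n k {T} (h , bottom , bounded) with initLast T
  triangles-complete n k (h , () , bounded) | []
  triangles-complete zero k (h , bottom , bounded) | [] ∷ʳ′ k′ = here (cong (_∷ []) (just-injective bottom))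
  triangles-complete zero k (h , bottom , bounded) | (r ∷ T′) ∷ʳ′ k′ =
    contradiction (ℕ.suc-injective (trans (cong suc (sym (length-∷ʳ T′ k′))) (IsHMT.order h))) λ ()
  triangles-complete (suc n) [] (h , bottom , bounded) | T′ ∷ʳ′ k′ =
    contradiction (IsHMT.shape h (2 ℕ.+ n) [] bottom) λ ()
  triangles-complete (suc n) (x ∷ ks) (h , bottom , bounded) | T′ ∷ʳ′ k′
    with IsHMT.order (IsHMT-init h)
  ... | T′-order with just-injective (trans (sym bottom) (subst (λ m → row (T′ ∷ʳ k′) (suc m) ≡ just k′) T′-order (row-last T′ k′)))
  ...   | refl with ‼-just T′ n (subst (n ℕ.<_) (sym T′-order) ℕ.≤-refl)
  ...     | l , bottom′ = ∈-concatMap⁺ (λ l → map (_∷ʳ (x ∷ ks)) (triangles b n l)) (lose l∈ (∈-map⁺ (_∷ʳ (x ∷ ks)) T′∈))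
    where
    open IsHMT h
    T = T′ ∷ʳ (x ∷ ks)
    old : ∀ j {y} → l ‼ j ≡ just y → ent T (suc n) (suc j) ≡ just y
    old j p = ent⁺ T (suc n) j (row-init T′ (x ∷ ks) (suc n) bottom′) p
    new : ∀ j {y} → (x ∷ ks) ‼ j ≡ just y → ent T (2 ℕ.+ n) (suc j) ≡ just y
    new j p = ent⁺ T (2 ℕ.+ n) j bottom p
    l∈ : l ∈ choose b (gaps (even n) (x ∷ ks))
    l∈ = ∈-choose⁺ (Interlaced-intro (even n) l x ks
      (trans (shape (2 ℕ.+ n) (x ∷ ks) bottom) (trans (⌈/2⌉-suc n)
        (cong (λ m → if even n then m else suc m) (sym (shape (suc n) l (row-init T′ (x ∷ ks) (suc n) bottom′))))))
      (λ j p q → rowInc (2 ℕ.+ n) (suc j) _ _ (new j p) (new (suc j) q))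
      (λ j p q → downL (suc n) (suc j) _ _ (old j p) (new j q))
      (λ j p q → downR (suc n) (suc j) _ _ (old j p) (new (suc j) q))
      (λ j p → bounded (suc n) (suc j) _ (old j p)))
    T′∈ : T′ ∈ triangles b n l
    T′∈ = triangles-complete n l (IsHMT-init h , bottom′ , λ i j y p → bounded i j y (ent-init T′ (x ∷ ks) i j p))

  triangles-bottom : ∀ n k {T} → T ∈ triangles b n k → ∃ λ T′ → T ≡ T′ ∷ʳ k
  triangles-bottom zero    k (here refl) = [] , refl
  triangles-bottom (suc n) k T∈ with ∈-triangles-suc⁻ n k T∈
  ... | _ , T′ , _ , _ , eq = T′ , eq

  -- Removing `k` exposes the row above it, from which `l` can be read off.
  triangles-disjoint : ∀ n k {l l′} → l ≢ l′ →
    Disjoint (map (_∷ʳ k) (triangles b n l)) (map (_∷ʳ k) (triangles b n l′))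
  triangles-disjoint n k {l} {l′} l≢l′ (T∈ , T∈′) with ∈-map⁻ (_∷ʳ k) T∈ | ∈-map⁻ (_∷ʳ k) T∈′
  ... | S , S∈ , refl | S′ , S′∈ , eq with List.∷ʳ-injectiveˡ S S′ eq
  ...   | refl with triangles-bottom n l S∈ | triangles-bottom n l′ S′∈
  ...     | U , refl | U′ , eq′ = l≢l′ (List.∷ʳ-injectiveʳ U U′ eq′)

  triangles-unique : ∀ n k → Unique (triangles b n k)
  triangles-unique zero    k = [] ∷ []
  triangles-unique (suc n) k = Unique.concat⁺
    (All.map⁺ (All.universal (λ l → Unique.map⁺ (List.∷ʳ-injectiveˡ _ _) (triangles-unique n l)) (choose b (gaps (even n) k))))
    (AllPairs.map⁺ (AllPairs.map (triangles-disjoint n k) (choose-unique b (gaps (even n) k))))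

-- Weights

sumUpTo : (ℕ → ℕ) → ℕ → ℕ
sumUpTo f n = sumℕ (List.applyUpTo f n)

sumUpTo-cong : ∀ n {f g : ℕ → ℕ} → (∀ i → f i ≡ g i) → sumUpTo f n ≡ sumUpTo g n
sumUpTo-cong zero    f≈g = refl
sumUpTo-cong (suc n) f≈g = cong₂ ℕ._+_ (f≈g 0) (sumUpTo-cong n (f≈g ∘ suc))

sumUpTo-zero : ∀ n {f : ℕ → ℕ} → (∀ i → f i ≡ 0) → sumUpTo f n ≡ 0
sumUpTo-zero zero    f≈0 = refl
sumUpTo-zero (suc n) f≈0 rewrite f≈0 0 = sumUpTo-zero n (f≈0 ∘ suc)

map-oneTo : ∀ {A : Set} (f : ℕ → A) n → map f (oneTo n) ≡ List.applyUpTo (f ∘ suc) n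
map-oneTo f n = trans (sym (List.map-∘ (List.upTo n))) (List.map-upTo (f ∘ suc) n)

sumℕ-++ : ∀ xs ys → sumℕ (xs ++ ys) ≡ sumℕ xs ℕ.+ sumℕ ys
sumℕ-++ []       ys = refl
sumℕ-++ (x ∷ xs) ys rewrite sumℕ-++ xs ys = sym (ℕ.+-assoc x _ _)

sumℕ-concatMap : ∀ {A : Set} (f : A → List ℕ) xs → sumℕ (concatMap f xs) ≡ sumℕ (map (sumℕ ∘ f) xs)
sumℕ-concatMap f []       = refl
sumℕ-concatMap f (x ∷ xs) = trans (sumℕ-++ (f x) (concatMap f xs)) (cong (sumℕ (f x) ℕ.+_) (sumℕ-concatMap f xs))

-- `specialAt` with the lookups abstracted: whether the right lower neighbour exists decides between
-- the ranges `gap` and `end`.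
special : Maybe ℤ → Maybe ℤ → Maybe ℤ → ℕ
special (just x) (just y) (just z) = specialIn (gap y z) x
special (just x) (just y) nothing  = specialIn (end y) x
special (just x) nothing  _        = 0
special nothing  _        _        = 0

specialAt≡special : ∀ T i j → specialAt T i j ≡ special (ent T i j) (ent T (suc i) j) (ent T (suc i) (suc j))
specialAt≡special T i j with ent T i j | ent T (suc i) j | ent T (suc i) (suc j)
... | just x  | just y  | just z  = refl
... | just x  | just y  | nothing = refl
... | just x  | nothing | _       = refl
... | nothing | _       | _       = refl

rowSpecial : List ℤ → List ℤ → ℕ
rowSpecial []      s       = 0
rowSpecial (x ∷ r) []      = 0
rowSpecial (x ∷ r) (y ∷ s) = special (just x) (just y) (s ‼ 0) ℕ.+ rowSpecial r s

special-nothing : ∀ x z → special x nothing z ≡ 0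
special-nothing (just _) z = refl
special-nothing nothing  z = refl

rowSpecial-sum : ∀ n r s → length r ℕ.≤ n →
  sumUpTo (λ j → special (r ‼ j) (s ‼ j) (s ‼ suc j)) n ≡ rowSpecial r s
rowSpecial-sum n       []      s       _         = sumUpTo-zero n (λ _ → refl)
rowSpecial-sum n       (x ∷ r) []      _         = sumUpTo-zero n (λ j → special-nothing ((x ∷ r) ‼ j) nothing)
rowSpecial-sum (suc n) (x ∷ r) (y ∷ s) (s≤s r≤n) = cong (special (just x) (just y) (s ‼ 0) ℕ.+_) (rowSpecial-sum n r s r≤n)

stackSpecial : Triangle → ℕ
stackSpecial []          = 0
stackSpecial (r ∷ [])    = 0
stackSpecial (r ∷ s ∷ T) = rowSpecial r s ℕ.+ stackSpecial (s ∷ T)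

rowSpecial? : Maybe (List ℤ) → Maybe (List ℤ) → ℕ
rowSpecial? (just r) (just s) = rowSpecial r s
rowSpecial? (just r) nothing  = 0
rowSpecial? nothing  _        = 0

stackSpecial-sum : ∀ T → sumUpTo (λ i → rowSpecial? (T ‼ i) (T ‼ suc i)) (length T) ≡ stackSpecial T
stackSpecial-sum []          = refl
stackSpecial-sum (r ∷ [])    = refl
stackSpecial-sum (r ∷ s ∷ T) = cong (rowSpecial r s ℕ.+_) (stackSpecial-sum (s ∷ T))

specialAt-row : ∀ n T i → (∀ r → row T (suc i) ≡ just r → length r ℕ.≤ n) →
  sumℕ (map (specialAt T (suc i)) (oneTo n)) ≡ rowSpecial? (T ‼ i) (T ‼ suc i)
specialAt-row n T i short = trans (cong sumℕ (map-oneTo (specialAt T (suc i)) n))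
  (trans (sumUpTo-cong n (λ j → specialAt≡special T (suc i) (suc j))) (lem short))
  where
  lem : (∀ r → T ‼ i ≡ just r → length r ℕ.≤ n) → sumUpTo (λ j → special (ent T (suc i) (suc j)) (ent T (2 ℕ.+ i) (suc j)) (ent T (2 ℕ.+ i) (2 ℕ.+ j))) n
          ≡ rowSpecial? (T ‼ i) (T ‼ suc i)
  lem sh with T ‼ i | T ‼ suc i
  ... | just r  | just s  = rowSpecial-sum n r s (sh r refl)
  ... | just r  | nothing = sumUpTo-zero n (λ j → special-nothing (r ‼ j) nothing)
  ... | nothing | _       = sumUpTo-zero n (λ _ → refl)

#special≡stackSpecial : ∀ {n T} → IsHMT n T → #special T ≡ stackSpecial T
#special≡stackSpecial {T = T} h = begin
  #special T
    ≡⟨ sumℕ-concatMap (λ i → map (specialAt T i) (oneTo N)) (oneTo N) ⟩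
  sumℕ (map (λ i → sumℕ (map (specialAt T i) (oneTo N))) (oneTo N))
    ≡⟨ cong sumℕ (map-oneTo (λ i → sumℕ (map (specialAt T i) (oneTo N))) N) ⟩
  sumUpTo (λ i → sumℕ (map (specialAt T (suc i)) (oneTo N))) N
    ≡⟨ sumUpTo-cong N (λ i → specialAt-row N T i (λ r → short (suc i))) ⟩
  sumUpTo (λ i → rowSpecial? (T ‼ i) (T ‼ suc i)) N
    ≡⟨ stackSpecial-sum T ⟩
  stackSpecial T ∎
  where
  open ≡-Reasoning
  N = length T
  -- `#special` runs over an N by N square of positions; it covers row i because ⌈ i /2⌉ ≤ i ≤ N.
  short : ∀ i {r} → row T i ≡ just r → length r ℕ.≤ N
  short i p = subst (ℕ._≤ N) (sym (IsHMT.shape h i _ p)) (ℕ.≤-trans (ℕ.⌈n/2⌉≤n i) (row-≤ T i p))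

-- Whether an entry is special depends only on the row below it, so a new bottom row affects only
-- the count for `l`.
stackSpecial-∷ʳ : ∀ T l k → row T (length T) ≡ just l → stackSpecial (T ∷ʳ k) ≡ rowSpecial l k ℕ.+ stackSpecial T
stackSpecial-∷ʳ (r ∷ [])    l k refl = refl
stackSpecial-∷ʳ (r ∷ s ∷ T) l k p rewrite stackSpecial-∷ʳ (s ∷ T) l k p = lem (rowSpecial r s) (rowSpecial l k) _
  where
  lem : ∀ a b c → a ℕ.+ (b ℕ.+ c) ≡ b ℕ.+ (a ℕ.+ c)
  lem a b c = trans (sym (ℕ.+-assoc a b c)) (trans (cong (ℕ._+ c) (ℕ.+-comm a b)) (ℕ.+-assoc b a c))

rangeSpecial : List Range → List ℤ → ℕ
rangeSpecial []       ts       = 0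
rangeSpecial (r ∷ rs) []       = 0
rangeSpecial (r ∷ rs) (t ∷ ts) = specialIn r t ℕ.+ rangeSpecial rs ts

rowSpecial≡rangeSpecial : ∀ {b e ls ks} → Interlaced b e ls ks → rowSpecial ls ks ≡ rangeSpecial (gaps e ks) ls
rowSpecial≡rangeSpecial (end _ _) = refl
rowSpecial≡rangeSpecial none      = refl
rowSpecial≡rangeSpecial {e = true}  (cons {x = x} {y} {t} _ _ _ il) = cong (specialIn (gap x y) t ℕ.+_) (rowSpecial≡rangeSpecial il)
rowSpecial≡rangeSpecial {e = false} (cons {x = x} {y} {t} _ _ _ il) = cong (specialIn (gap x y) t ℕ.+_) (rowSpecial≡rangeSpecial il)

weight-∷ʳ : ∀ {b e n T l k} → IsHMT n T → row T n ≡ just l → length k ≡ ⌈ suc n /2⌉ → Interlaced b e l k →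
  weight (T ∷ʳ k) ≡ 2 ℕ.^ rangeSpecial (gaps e k) l ℕ.* weight T
weight-∷ʳ {e = e} {n} {T} {l} {k} h bottom len il = begin
  2 ℕ.^ #special (T ∷ʳ k)
    ≡⟨ cong (2 ℕ.^_) (#special≡stackSpecial (IsHMT-∷ʳ h bottom len il)) ⟩
  2 ℕ.^ stackSpecial (T ∷ʳ k)
    ≡⟨ cong (2 ℕ.^_) (stackSpecial-∷ʳ T l k (subst (λ m → row T m ≡ just l) (sym (IsHMT.order h)) bottom)) ⟩
  2 ℕ.^ (rowSpecial l k ℕ.+ stackSpecial T)
    ≡⟨ cong (2 ℕ.^_) (cong₂ ℕ._+_ (rowSpecial≡rangeSpecial il) (sym (#special≡stackSpecial h))) ⟩
  2 ℕ.^ (rangeSpecial (gaps e k) l ℕ.+ #special T)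
    ≡⟨ ℕ.^-distribˡ-+-* 2 (rangeSpecial (gaps e k) l) (#special T) ⟩
  2 ℕ.^ rangeSpecial (gaps e k) l ℕ.* weight T ∎
  where open ≡-Reasoning

∑ : {A : Set} → (A → ℤ) → List A → ℤ
∑ f []       = + 0
∑ f (x ∷ xs) = f x + ∑ f xs

module _ {A : Set} where

  ∑-cong-∈ : ∀ (xs : List A) {f g : A → ℤ} → (∀ {x} → x ∈ xs → f x ≡ g x) → ∑ f xs ≡ ∑ g xs
  ∑-cong-∈ []       f≈g = refl
  ∑-cong-∈ (x ∷ xs) f≈g = cong₂ _+_ (f≈g (here refl)) (∑-cong-∈ xs (f≈g ∘ there))

  ∑-scale : ∀ c (f : A → ℤ) xs → ∑ (λ x → c * f x) xs ≡ c * ∑ f xs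
  ∑-scale c f []       = sym (ℤ.*-zeroʳ c)
  ∑-scale c f (x ∷ xs) rewrite ∑-scale c f xs = sym (ℤ.*-distribˡ-+ c (f x) _)

  ∑-++ : ∀ (f : A → ℤ) xs ys → ∑ f (xs ++ ys) ≡ ∑ f xs + ∑ f ys
  ∑-++ f []       ys = sym (ℤ.+-identityˡ _)
  ∑-++ f (x ∷ xs) ys rewrite ∑-++ f xs ys = sym (ℤ.+-assoc (f x) _ _)

  ∑-map : ∀ {B : Set} (f : A → ℤ) (g : B → A) xs → ∑ f (map g xs) ≡ ∑ (f ∘ g) xs
  ∑-map f g []       = refl
  ∑-map f g (x ∷ xs) = cong (λ v → f (g x) + v) (∑-map f g xs)

  ∑-concatMap : ∀ {B : Set} (f : A → ℤ) (g : B → List A) xs → ∑ f (concatMap g xs) ≡ ∑ (λ x → ∑ f (g x)) xs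
  ∑-concatMap f g []       = refl
  ∑-concatMap f g (x ∷ xs) = trans (∑-++ f (g x) (concatMap g xs)) (cong (λ v → ∑ f (g x) + v) (∑-concatMap f g xs))

  sumℕ-∑ : ∀ (f : A → ℕ) xs → + sumℕ (map f xs) ≡ ∑ (λ x → + f x) xs
  sumℕ-∑ f []       = refl
  sumℕ-∑ f (x ∷ xs) = trans (ℤ.pos-+ (f x) _) (cong (λ v → + f x + v) (sumℕ-∑ f xs))

-- The power of 2 is multiplicative over the entries of a row, so the sum over rows becomes an
-- iterated sum with the weights of `choices`.
choose-sum : ∀ b rs (F : List ℤ → ℤ) →
  ∑ (λ ls → + (2 ℕ.^ rangeSpecial rs ls) * F ls) (choose b rs) ≡ sumOver (choices b) rs F
choose-sum b []       F = lem (F [])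
  where
  lem : ∀ u → + 1 * u + + 0 ≡ u
  lem = solve-∀
choose-sum b (r ∷ rs) F = go (ranges b r)
  where
  open ≡-Reasoning
  W : List ℤ → ℤ
  W ls = + (2 ℕ.^ rangeSpecial (r ∷ rs) ls) * F ls
  split : ∀ t ls → W (t ∷ ls) ≡ + (2 ℕ.^ specialIn r t) * (+ (2 ℕ.^ rangeSpecial rs ls) * F (t ∷ ls))
  split t ls = trans
    (cong (_* F (t ∷ ls)) (trans (cong +_ (ℕ.^-distribˡ-+-* 2 (specialIn r t) (rangeSpecial rs ls)))
                                 (ℤ.pos-* (2 ℕ.^ specialIn r t) (2 ℕ.^ rangeSpecial rs ls))))
    (ℤ.*-assoc (+ (2 ℕ.^ specialIn r t)) (+ (2 ℕ.^ rangeSpecial rs ls)) (F (t ∷ ls)))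
  go : ∀ ts → ∑ W (cartesianProductWith _∷_ ts (choose b rs))
              ≡ weighted (map (weigh r) ts) (λ t → sumOver (choices b) rs (F ∘ (t ∷_)))
  go []       = refl
  go (t ∷ ts) = begin
    ∑ W (map (t ∷_) (choose b rs) ++ cartesianProductWith _∷_ ts (choose b rs))
      ≡⟨ ∑-++ W (map (t ∷_) (choose b rs)) _ ⟩
    ∑ W (map (t ∷_) (choose b rs)) + ∑ W (cartesianProductWith _∷_ ts (choose b rs))
      ≡⟨ cong₂ _+_ first (go ts) ⟩
    + (2 ℕ.^ specialIn r t) * sumOver (choices b) rs (F ∘ (t ∷_))
      + weighted (map (weigh r) ts) (λ t → sumOver (choices b) rs (F ∘ (t ∷_))) ∎
    where
    first : ∑ W (map (t ∷_) (choose b rs)) ≡ + (2 ℕ.^ specialIn r t) * sumOver (choices b) rs (F ∘ (t ∷_))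
    first = begin
      ∑ W (map (t ∷_) (choose b rs))
        ≡⟨ ∑-map W (t ∷_) (choose b rs) ⟩
      ∑ (λ ls → W (t ∷ ls)) (choose b rs)
        ≡⟨ ∑-cong-∈ (choose b rs) (λ {ls} _ → split t ls) ⟩
      ∑ (λ ls → + (2 ℕ.^ specialIn r t) * (+ (2 ℕ.^ rangeSpecial rs ls) * F (t ∷ ls))) (choose b rs)
        ≡⟨ ∑-scale (+ (2 ℕ.^ specialIn r t)) (λ ls → + (2 ℕ.^ rangeSpecial rs ls) * F (t ∷ ls)) (choose b rs) ⟩
      + (2 ℕ.^ specialIn r t) * ∑ (λ ls → + (2 ℕ.^ rangeSpecial rs ls) * F (t ∷ ls)) (choose b rs)
        ≡⟨ cong (+ (2 ℕ.^ specialIn r t) *_) (choose-sum b rs (F ∘ (t ∷_))) ⟩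
      + (2 ℕ.^ specialIn r t) * sumOver (choices b) rs (F ∘ (t ∷_)) ∎

stepC : Bool → ℕ → ℤ
stepC true  = evenC
stepC false = oddC

scale : ℕ → ℤ
scale zero    = + 1
scale (suc n) = ∏ₙ (stepC (even n)) 0 ⌈ suc n /2⌉ * scale n

module _ (b : ℤ) where

  total : ℕ → List ℤ → ℤ
  total n k = ∑ (λ T → + weight T) (triangles b n k)

  total-suc : ∀ n x ks → length (x ∷ ks) ≡ ⌈ 2 ℕ.+ n /2⌉ → WeaklyIncreasing b (x ∷ ks) →
    total (suc n) (x ∷ ks) ≡ ∑ (λ l → + (2 ℕ.^ rangeSpecial (gaps (even n) (x ∷ ks)) l) * total n l) (choose b (gaps (even n) (x ∷ ks)))
  total-suc n x ks len inc = trans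
    (∑-concatMap (λ T → + weight T) (λ l → map (_∷ʳ (x ∷ ks)) (triangles b n l)) (choose b (gaps (even n) (x ∷ ks))))
    (∑-cong-∈ (choose b (gaps (even n) (x ∷ ks))) (λ {l} → per-row l))
    where
    open ≡-Reasoning
    per-row : ∀ l → l ∈ choose b (gaps (even n) (x ∷ ks)) →
      ∑ (λ T → + weight T) (map (_∷ʳ (x ∷ ks)) (triangles b n l))
        ≡ + (2 ℕ.^ rangeSpecial (gaps (even n) (x ∷ ks)) l) * total n l
    per-row l l∈ = begin
      ∑ (λ T → + weight T) (map (_∷ʳ (x ∷ ks)) (triangles b n l))
        ≡⟨ ∑-map (λ T → + weight T) (_∷ʳ (x ∷ ks)) (triangles b n l) ⟩
      ∑ (λ T → + weight (T ∷ʳ (x ∷ ks))) (triangles b n l)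
        ≡⟨ ∑-cong-∈ (triangles b n l) (λ {T} → per-triangle l l∈) ⟩
      ∑ (λ T → + (2 ℕ.^ rangeSpecial (gaps (even n) (x ∷ ks)) l) * + weight T) (triangles b n l)
        ≡⟨ ∑-scale (+ (2 ℕ.^ rangeSpecial (gaps (even n) (x ∷ ks)) l)) (λ T → + weight T) (triangles b n l) ⟩
      + (2 ℕ.^ rangeSpecial (gaps (even n) (x ∷ ks)) l) * total n l ∎
      where
      per-triangle : ∀ l → l ∈ choose b (gaps (even n) (x ∷ ks)) → ∀ {T} → T ∈ triangles b n l →
        + weight (T ∷ʳ (x ∷ ks)) ≡ + (2 ℕ.^ rangeSpecial (gaps (even n) (x ∷ ks)) l) * + weight T
      per-triangle l l∈ {T} T∈ with ∈-choose⁻ (even n) x ks l∈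
      per-triangle []       l∈ {T} T∈ | il = contradiction (length-above n il len) λ ()
      per-triangle (t ∷ ls) l∈ {T} T∈ | il
        with triangles-sound b n (t ∷ ls) (length-above n il len) (Interlaced-WeaklyIncreasing il inc) T∈
      ... | h , bottom , _ = trans (cong +_ (weight-∷ʳ h bottom len il)) (ℤ.pos-* (2 ℕ.^ rangeSpecial (gaps (even n) (x ∷ ks)) (t ∷ ls)) (weight T))

  family : Bool → ℕ → ℤ → ℤ
  family true  i x = E i (τ b x)
  family false i x = O i (τ b x)

  step : ∀ e m {ks} → length ks ≡ (if e then m else suc m) → WeaklyIncreasing b ks →
    ∏ₙ (stepC e) 0 m * sumOver (choices b) (gaps e ks) (det (family e) 0 m) ≡ det (family (not e)) 0 (length ks) ks
  step true  m len inc rewrite len = even-step b m inc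
  step false m len inc rewrite len = odd-step b m inc

  -- The rows given by `choose` are only weakly increasing, so the induction has to include such
  -- rows. With a repeated entry both sides are 0: on the left a gap is empty, on the right the
  -- determinant alternates.
  total-det : ∀ n ks → length ks ≡ ⌈ suc n /2⌉ → WeaklyIncreasing b ks →
    scale n * total n ks ≡ det (family (even n)) 0 (length ks) ks
  total-det zero    (x ∷ [])  len inc = refl
  total-det (suc n) (x ∷ ks₀) len inc = begin
    P * scale n * total (suc n) ks
      ≡⟨ cong (P * scale n *_) (total-suc n x ks₀ len inc) ⟩
    P * scale n * ∑ (λ l → w l * total n l) (choose b rs)
      ≡⟨ ℤ.*-assoc P (scale n) _ ⟩
    P * (scale n * ∑ (λ l → w l * total n l) (choose b rs))
      ≡⟨ cong (P *_) (∑-scale (scale n) (λ l → w l * total n l) (choose b rs)) ⟨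
    P * ∑ (λ l → scale n * (w l * total n l)) (choose b rs)
      ≡⟨ cong (P *_) (∑-cong-∈ (choose b rs) (λ {l} → per-row l)) ⟩
    P * ∑ (λ l → w l * det (family (even n)) 0 m l) (choose b rs)
      ≡⟨ cong (P *_) (choose-sum b rs (det (family (even n)) 0 m)) ⟩
    P * sumOver (choices b) rs (det (family (even n)) 0 m)
      ≡⟨ step (even n) m (trans len (⌈/2⌉-suc n)) inc ⟩
    det (family (even (suc n))) 0 (length ks) ks ∎
    where
    open ≡-Reasoning
    ks = x ∷ ks₀
    m = ⌈ suc n /2⌉
    P = ∏ₙ (stepC (even n)) 0 m
    rs = gaps (even n) ks
    w : List ℤ → ℤ
    w l = + (2 ℕ.^ rangeSpecial rs l)
    lem : ∀ a b c → a * (b * c) ≡ b * (a * c)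
    lem = solve-∀
    hypothesis : ∀ l → Interlaced b (even n) l ks → scale n * total n l ≡ det (family (even n)) 0 m l
    hypothesis []       il = contradiction (length-above n il len) λ ()
    hypothesis (t ∷ ls) il = subst (λ i → scale n * total n (t ∷ ls) ≡ det (family (even n)) 0 i (t ∷ ls))
      (length-above n il len)
      (total-det n (t ∷ ls) (length-above n il len) (Interlaced-WeaklyIncreasing il inc))
    per-row : ∀ l → l ∈ choose b rs → scale n * (w l * total n l) ≡ w l * det (family (even n)) 0 m l
    per-row l l∈ = trans (lem (scale n) (w l) (total n l))
      (cong (w l *_) (hypothesis l (∈-choose⁻ (even n) x ks₀ l∈)))

-- Products of factorials

∏ₙ-cong : ∀ {c d : ℕ → ℤ} → (∀ i → c i ≡ d i) → ∀ i m → ∏ₙ c i m ≡ ∏ₙ d i m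
∏ₙ-cong c≈d i zero    = refl
∏ₙ-cong c≈d i (suc m) = cong₂ _*_ (c≈d i) (∏ₙ-cong c≈d (suc i) m)

∏ₙ-* : ∀ (c d : ℕ → ℤ) i m → ∏ₙ c i m * ∏ₙ d i m ≡ ∏ₙ (λ j → c j * d j) i m
∏ₙ-* c d i zero    = refl
∏ₙ-* c d i (suc m) = trans (lem (c i) (∏ₙ c (suc i) m) (d i) (∏ₙ d (suc i) m)) (cong (c i * d i *_) (∏ₙ-* c d (suc i) m))
  where
  lem : ∀ a b c d → a * b * (c * d) ≡ a * c * (b * d)
  lem = solve-∀

∏ₙ-shift : ∀ (c : ℕ → ℤ) i m → ∏ₙ (c ∘ suc) i m ≡ ∏ₙ c (suc i) m
∏ₙ-shift c i zero    = refl
∏ₙ-shift c i (suc m) = cong (c (suc i) *_) (∏ₙ-shift c (suc i) m)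

∏ₙ-last : ∀ (c : ℕ → ℤ) i m → ∏ₙ c i (suc m) ≡ ∏ₙ c i m * c (i ℕ.+ m)
∏ₙ-last c i zero    rewrite ℕ.+-identityʳ i = ℤ.*-comm (c i) (+ 1)
∏ₙ-last c i (suc m) rewrite ℕ.+-suc i m =
  trans (cong (c i *_) (∏ₙ-last c (suc i) m)) (sym (ℤ.*-assoc (c i) (∏ₙ c (suc i) m) (c (suc i ℕ.+ m))))

-- The normalising factorials of `E i` and `O i`. The factors `evenC i` and `oddC i` lead from each
-- factorial to the next.
factorials : Bool → ℕ → ℤ
factorials true  i = + ((i ℕ.+ i) !)
factorials false i = + (suc (i ℕ.+ i) !)

+2* : ∀ i → + 2 * + i ≡ + (i ℕ.+ i)
+2* i = trans (lem (+ i)) (sym (ℤ.pos-+ i i))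
  where
  lem : ∀ i → + 2 * i ≡ i + i
  lem = solve-∀

evenC-factorial : ∀ i → evenC i * factorials true i ≡ factorials false i
evenC-factorial i = begin
  (+ 2 * + i + + 1) * factorials true i ≡⟨ cong (λ u → (u + + 1) * factorials true i) (+2* i) ⟩
  + (i ℕ.+ i ℕ.+ 1) * factorials true i ≡⟨ cong (λ u → + u * factorials true i) (ℕ.+-comm (i ℕ.+ i) 1) ⟩
  + suc (i ℕ.+ i) * + ((i ℕ.+ i) !)     ≡⟨ ℤ.pos-* (suc (i ℕ.+ i)) ((i ℕ.+ i) !) ⟨
  factorials false i                    ∎
  where open ≡-Reasoning

oddC-factorial : ∀ i → oddC i * factorials false i ≡ factorials true (suc i)
oddC-factorial i = begin
  (+ 2 * + i + + 2) * factorials false i        ≡⟨ cong (λ u → (u + + 2) * factorials false i) (+2* i) ⟩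
  + (i ℕ.+ i ℕ.+ 2) * factorials false i        ≡⟨ cong (λ u → + u * factorials false i) (ℕ.+-comm (i ℕ.+ i) 2) ⟩
  + (2 ℕ.+ (i ℕ.+ i)) * + (suc (i ℕ.+ i) !)     ≡⟨ ℤ.pos-* (2 ℕ.+ (i ℕ.+ i)) (suc (i ℕ.+ i) !) ⟨
  + ((2 ℕ.+ (i ℕ.+ i)) !)                       ≡⟨ cong (λ u → + (u !)) (cong suc (ℕ.+-suc i i)) ⟨
  factorials true (suc i)                       ∎
  where open ≡-Reasoning

scale-step : ∀ e m → ∏ₙ (stepC e) 0 m * ∏ₙ (factorials e) 0 m ≡ ∏ₙ (factorials (not e)) 0 (if e then m else suc m)
scale-step true  m = trans (∏ₙ-* evenC (factorials true) 0 m) (∏ₙ-cong evenC-factorial 0 m)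
scale-step false m = begin
  ∏ₙ oddC 0 m * ∏ₙ (factorials false) 0 m     ≡⟨ ∏ₙ-* oddC (factorials false) 0 m ⟩
  ∏ₙ (λ i → oddC i * factorials false i) 0 m  ≡⟨ ∏ₙ-cong oddC-factorial 0 m ⟩
  ∏ₙ (factorials true ∘ suc) 0 m              ≡⟨ ∏ₙ-shift (factorials true) 0 m ⟩
  -- The product may start at index 0, whose factor is 0! = 1.
  ∏ₙ (factorials true) 1 m                    ≡⟨ ℤ.*-identityˡ (∏ₙ (factorials true) 1 m) ⟨
  ∏ₙ (factorials true) 0 (suc m)              ∎
  where open ≡-Reasoning

scale-factorials : ∀ n → scale n ≡ ∏ₙ (factorials (even n)) 0 ⌈ suc n /2⌉
scale-factorials zero    = refl
scale-factorials (suc n) = trans (cong (∏ₙ (stepC (even n)) 0 ⌈ suc n /2⌉ *_) (scale-factorials n))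
  (trans (scale-step (even n) ⌈ suc n /2⌉)
         (cong (∏ₙ (factorials (not (even n))) 0) (sym (⌈/2⌉-suc n))))

Positive : ℤ → Set
Positive z = ∃ λ d → z ≡ + suc d

factorials-positive : ∀ e i → Positive (factorials e i)
factorials-positive e i with e
... | true  = ℕ.pred ((i ℕ.+ i) !) , cong +_ (sym (ℕ.suc-pred ((i ℕ.+ i) !) {{(i ℕ.+ i) ℕ.!≢0}}))
... | false = ℕ.pred (suc (i ℕ.+ i) !) , cong +_ (sym (ℕ.suc-pred (suc (i ℕ.+ i) !) {{suc (i ℕ.+ i) ℕ.!≢0}}))

∏ₙ-positive : ∀ {c : ℕ → ℤ} → (∀ i → Positive (c i)) → ∀ i m → Positive (∏ₙ c i m)
∏ₙ-positive pos i zero    = 0 , refl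
∏ₙ-positive pos i (suc m) with pos i | ∏ₙ-positive pos (suc i) m
... | d , p | d′ , p′ rewrite p | p′ = _ , sym (ℤ.pos-* (suc d) (suc d′))

module _ {A : Set} where

  ∏ℤ-cong-All : ∀ {V : A → Set} {f g : A → ℤ} → (∀ x → V x → f x ≡ g x) → ∀ {xs} → All V xs → ∏ℤ f xs ≡ ∏ℤ g xs
  ∏ℤ-cong-All f≈g []       = refl
  ∏ℤ-cong-All f≈g (v ∷ vs) = cong₂ _*_ (f≈g _ v) (∏ℤ-cong-All f≈g vs)

  ∏ℤ-cong : ∀ {f g : A → ℤ} → (∀ x → f x ≡ g x) → ∀ xs → ∏ℤ f xs ≡ ∏ℤ g xs
  ∏ℤ-cong f≈g []       = refl
  ∏ℤ-cong f≈g (x ∷ xs) = cong₂ _*_ (f≈g x) (∏ℤ-cong f≈g xs)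

  ∏ℤ-++ : ∀ (f : A → ℤ) xs ys → ∏ℤ f (xs ++ ys) ≡ ∏ℤ f xs * ∏ℤ f ys
  ∏ℤ-++ f []       ys = sym (ℤ.*-identityˡ _)
  ∏ℤ-++ f (x ∷ xs) ys = trans (cong (f x *_) (∏ℤ-++ f xs ys)) (sym (ℤ.*-assoc (f x) _ _))

  ∏ℤ-map : ∀ {B : Set} (f : A → ℤ) (g : B → A) xs → ∏ℤ f (map g xs) ≡ ∏ℤ (f ∘ g) xs
  ∏ℤ-map f g []       = refl
  ∏ℤ-map f g (x ∷ xs) = cong (f (g x) *_) (∏ℤ-map f g xs)

  ∏ℤ-* : ∀ (f g : A → ℤ) xs → ∏ℤ (λ x → f x * g x) xs ≡ ∏ℤ f xs * ∏ℤ g xs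
  ∏ℤ-* f g []       = refl
  ∏ℤ-* f g (x ∷ xs) = trans (cong (f x * g x *_) (∏ℤ-* f g xs)) (lem (f x) (g x) (∏ℤ f xs) (∏ℤ g xs))
    where
    lem : ∀ a b c d → a * b * (c * d) ≡ a * c * (b * d)
    lem = solve-∀

oneTo-∷ʳ : ∀ m → oneTo (suc m) ≡ oneTo m ∷ʳ suc m
oneTo-∷ʳ m = trans (cong (map suc) (sym (List.upTo-∷ʳ m))) (List.map-++ suc (List.upTo m) (m ∷ []))

oneTo-∷ : ∀ m → oneTo (suc m) ≡ 1 ∷ map suc (oneTo m)
oneTo-∷ m = cong (λ l → 1 ∷ map suc l) (sym (List.map-upTo suc m))

∏-oneTo-first : ∀ (f : ℕ → ℤ) m → ∏ℤ f (oneTo (suc m)) ≡ f 1 * ∏ℤ (f ∘ suc) (oneTo m)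
∏-oneTo-first f m = trans (cong (∏ℤ f) (oneTo-∷ m)) (cong (f 1 *_) (∏ℤ-map f suc (oneTo m)))

∏-oneTo-last : ∀ (f : ℕ → ℤ) m → ∏ℤ f (oneTo (suc m)) ≡ ∏ℤ f (oneTo m) * f (suc m)
∏-oneTo-last f m = trans (cong (∏ℤ f) (oneTo-∷ʳ m))
  (trans (∏ℤ-++ f (oneTo m) (suc m ∷ [])) (cong (∏ℤ f (oneTo m) *_) (ℤ.*-identityʳ (f (suc m)))))

∏-pairs-last : ∀ (f : ℕ × ℕ → ℤ) m →
  ∏ℤ f (pairs (suc m)) ≡ ∏ℤ f (pairs m) * ∏ℤ (λ i → f (i , suc m)) (oneTo m)
∏-pairs-last f m = begin
  ∏ℤ f (pairs (suc m))
    ≡⟨ cong (∏ℤ f ∘ concatMap column) (oneTo-∷ʳ m) ⟩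
  ∏ℤ f (concatMap column (oneTo m ∷ʳ suc m))
    ≡⟨ cong (∏ℤ f) (List.concatMap-++ column (oneTo m) (suc m ∷ [])) ⟩
  ∏ℤ f (pairs m ++ column (suc m) ++ [])
    ≡⟨ ∏ℤ-++ f (pairs m) (column (suc m) ++ []) ⟩
  ∏ℤ f (pairs m) * ∏ℤ f (column (suc m) ++ [])
    ≡⟨ cong (λ l → ∏ℤ f (pairs m) * ∏ℤ f l) (List.++-identityʳ (column (suc m))) ⟩
  ∏ℤ f (pairs m) * ∏ℤ f (column (suc m))
    ≡⟨ cong (∏ℤ f (pairs m) *_) (∏ℤ-map f (λ i → i , suc m) (oneTo m)) ⟩
  ∏ℤ f (pairs m) * ∏ℤ (λ i → f (i , suc m)) (oneTo m) ∎
  where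
  open ≡-Reasoning
  column : ℕ → List (ℕ × ℕ)
  column j = map (λ i → (i , j)) (oneTo (j ∸ 1))

-- Denominators are evaluated by removing the largest j, as `pairs` is built; numerators follow the
-- vector `k` from its head and need the smallest i removed.
∏-pairs-first : ∀ (f : ℕ × ℕ → ℤ) m →
  ∏ℤ f (pairs (suc m)) ≡ ∏ℤ (λ j → f (1 , suc j)) (oneTo m) * ∏ℤ (λ { (i , j) → f (suc i , suc j) }) (pairs m)
∏-pairs-first f zero    = refl
∏-pairs-first f (suc m) = begin
  ∏ℤ f (pairs (2 ℕ.+ m))
    ≡⟨ ∏-pairs-last f (suc m) ⟩
  ∏ℤ f (pairs (suc m)) * ∏ℤ (λ i → f (i , 2 ℕ.+ m)) (oneTo (suc m))
    ≡⟨ cong₂ _*_ (∏-pairs-first f m) (∏-oneTo-first (λ i → f (i , 2 ℕ.+ m)) m) ⟩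
  a * ∏ℤ f′ (pairs m) * (f (1 , 2 ℕ.+ m) * c)
    ≡⟨ lem a (∏ℤ f′ (pairs m)) (f (1 , 2 ℕ.+ m)) c ⟩
  a * f (1 , 2 ℕ.+ m) * (∏ℤ f′ (pairs m) * c)
    ≡⟨ cong₂ _*_ (∏-oneTo-last (λ j → f (1 , suc j)) m) (∏-pairs-last f′ m) ⟨
  ∏ℤ (λ j → f (1 , suc j)) (oneTo (suc m)) * ∏ℤ f′ (pairs (suc m)) ∎
  where
  open ≡-Reasoning
  f′ : ℕ × ℕ → ℤ
  f′ = λ { (i , j) → f (suc i , suc j) }
  a = ∏ℤ (λ j → f (1 , suc j)) (oneTo m)
  c = ∏ℤ (λ i → f (suc i , 2 ℕ.+ m)) (oneTo m)
  lem : ∀ a b c d → a * b * (c * d) ≡ a * c * (b * d)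
  lem = solve-∀

∏-descending : ∀ m → ∏ℤ (λ i → + (suc m ∸ i)) (oneTo m) ≡ + (m !)
∏-descending zero    = refl
∏-descending (suc m) = trans (∏-oneTo-first (λ i → + (2 ℕ.+ m ∸ i)) m)
  (trans (cong (+ suc m *_) (∏-descending m)) (sym (ℤ.pos-* (suc m) (m !))))

∏-ascending : ∀ a m → ∏ℤ (λ i → + (i ℕ.+ a)) (oneTo m) * + (a !) ≡ + ((m ℕ.+ a) !)
∏-ascending a zero    = ℤ.*-identityˡ (+ (a !))
∏-ascending a (suc m) = begin
  ∏ℤ (λ i → + (i ℕ.+ a)) (oneTo (suc m)) * + (a !)
    ≡⟨ cong (_* + (a !)) (∏-oneTo-last (λ i → + (i ℕ.+ a)) m) ⟩
  ∏ℤ (λ i → + (i ℕ.+ a)) (oneTo m) * + (suc m ℕ.+ a) * + (a !)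
    ≡⟨ lem (∏ℤ (λ i → + (i ℕ.+ a)) (oneTo m)) (+ (suc m ℕ.+ a)) (+ (a !)) ⟩
  + (suc m ℕ.+ a) * (∏ℤ (λ i → + (i ℕ.+ a)) (oneTo m) * + (a !))
    ≡⟨ cong (+ (suc m ℕ.+ a) *_) (∏-ascending a m) ⟩
  + (suc m ℕ.+ a) * + ((m ℕ.+ a) !)
    ≡⟨ ℤ.pos-* (suc m ℕ.+ a) ((m ℕ.+ a) !) ⟨
  + ((suc m ℕ.+ a) !) ∎
  where
  open ≡-Reasoning
  lem : ∀ a b c → a * b * c ≡ b * (a * c)
  lem = solve-∀

oddDen evenDen : ℕ × ℕ → ℤ
oddDen  (i , j) = + ((j ∸ i) ℕ.* (i ℕ.+ j ∸ 1))
evenDen (i , j) = + ((j ∸ i) ℕ.* (i ℕ.+ j))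

-- The column j = m + 1 contributes m! from the differences and (2m)! / m! from the sums, together
-- (2m)!.
∏-oddDen : ∀ m → ∏ℤ oddDen (pairs m) ≡ ∏ₙ (factorials true) 0 m
∏-oddDen zero    = refl
∏-oddDen (suc m) = begin
  ∏ℤ oddDen (pairs (suc m))
    ≡⟨ ∏-pairs-last oddDen m ⟩
  ∏ℤ oddDen (pairs m) * ∏ℤ (λ i → oddDen (i , suc m)) (oneTo m)
    ≡⟨ cong₂ _*_ (∏-oddDen m) column ⟩
  ∏ₙ (factorials true) 0 m * factorials true m
    ≡⟨ ∏ₙ-last (factorials true) 0 m ⟨
  ∏ₙ (factorials true) 0 (suc m) ∎
  where
  open ≡-Reasoning
  split : ∀ i → oddDen (i , suc m) ≡ + (i ℕ.+ m) * + (suc m ∸ i)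
  split i rewrite ℕ.+-suc i m = trans (ℤ.pos-* (suc m ∸ i) (i ℕ.+ m)) (ℤ.*-comm (+ (suc m ∸ i)) (+ (i ℕ.+ m)))
  column : ∏ℤ (λ i → oddDen (i , suc m)) (oneTo m) ≡ factorials true m
  column = begin
    ∏ℤ (λ i → oddDen (i , suc m)) (oneTo m)
      ≡⟨ ∏ℤ-cong split (oneTo m) ⟩
    ∏ℤ (λ i → + (i ℕ.+ m) * + (suc m ∸ i)) (oneTo m)
      ≡⟨ ∏ℤ-* (λ i → + (i ℕ.+ m)) (λ i → + (suc m ∸ i)) (oneTo m) ⟩
    ∏ℤ (λ i → + (i ℕ.+ m)) (oneTo m) * ∏ℤ (λ i → + (suc m ∸ i)) (oneTo m)
      ≡⟨ cong (∏ℤ (λ i → + (i ℕ.+ m)) (oneTo m) *_) (∏-descending m) ⟩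
    ∏ℤ (λ i → + (i ℕ.+ m)) (oneTo m) * + (m !)
      ≡⟨ ∏-ascending m m ⟩
    factorials true m ∎

-- The column j = m + 1 contributes m! (2m+1)! / (m+1)!, and the factor m + 1 of the single product
-- completes it to (2m+1)!.
∏-evenDen : ∀ m → ∏ℤ evenDen (pairs m) * ∏ℤ +_ (oneTo m) ≡ ∏ₙ (factorials false) 0 m
∏-evenDen zero    = refl
∏-evenDen (suc m) = begin
  ∏ℤ evenDen (pairs (suc m)) * ∏ℤ +_ (oneTo (suc m))
    ≡⟨ cong₂ _*_ (∏-pairs-last evenDen m) (∏-oneTo-last +_ m) ⟩
  ∏ℤ evenDen (pairs m) * col * (∏ℤ +_ (oneTo m) * + suc m)
    ≡⟨ lem (∏ℤ evenDen (pairs m)) col (∏ℤ +_ (oneTo m)) (+ suc m) ⟩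
  ∏ℤ evenDen (pairs m) * ∏ℤ +_ (oneTo m) * (col * + suc m)
    ≡⟨ cong₂ _*_ (∏-evenDen m) column ⟩
  ∏ₙ (factorials false) 0 m * factorials false m
    ≡⟨ ∏ₙ-last (factorials false) 0 m ⟨
  ∏ₙ (factorials false) 0 (suc m) ∎
  where
  open ≡-Reasoning
  lem : ∀ a b c d → a * b * (c * d) ≡ a * c * (b * d)
  lem = solve-∀
  lem₂ : ∀ a b c → a * b * c ≡ a * (c * b)
  lem₂ = solve-∀
  col = ∏ℤ (λ i → evenDen (i , suc m)) (oneTo m)
  asc = ∏ℤ (λ i → + (i ℕ.+ suc m)) (oneTo m)
  split : ∀ i → evenDen (i , suc m) ≡ + (i ℕ.+ suc m) * + (suc m ∸ i)
  split i = trans (ℤ.pos-* (suc m ∸ i) (i ℕ.+ suc m)) (ℤ.*-comm (+ (suc m ∸ i)) (+ (i ℕ.+ suc m)))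
  column : col * + suc m ≡ factorials false m
  column = begin
    col * + suc m
      ≡⟨ cong (_* + suc m) (trans (∏ℤ-cong split (oneTo m)) (∏ℤ-* (λ i → + (i ℕ.+ suc m)) (λ i → + (suc m ∸ i)) (oneTo m))) ⟩
    asc * ∏ℤ (λ i → + (suc m ∸ i)) (oneTo m) * + suc m
      ≡⟨ cong (λ u → asc * u * + suc m) (∏-descending m) ⟩
    asc * + (m !) * + suc m
      ≡⟨ lem₂ asc (+ (m !)) (+ suc m) ⟩
    asc * (+ suc m * + (m !))
      ≡⟨ cong (asc *_) (ℤ.pos-* (suc m) (m !)) ⟨
    asc * + (suc m !)
      ≡⟨ ∏-ascending (suc m) m ⟩
    + ((m ℕ.+ suc m) !)
      ≡⟨ cong (λ u → + (u !)) (ℕ.+-suc m m) ⟩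
    factorials false m ∎

-- The product formulas

pairProduct : (ℤ → ℤ → ℤ) → List ℤ → ℤ
pairProduct h []       = + 1
pairProduct h (x ∷ xs) = ∏ℤ (h x) xs * pairProduct h xs

kAt-suc : ∀ {m} x (k : Vec ℤ m) i → kAt (x ∷ k) (2 ℕ.+ i) ≡ kAt k (suc i)
kAt-suc x k i with Vec.toList k ‼ i
... | just _  = refl
... | nothing = refl

oneTo-positive : ∀ m → All ℕ.NonZero (oneTo m)
oneTo-positive m = All.map⁺ (All.universal (λ _ → _) (List.upTo m))

Ordered : ℕ × ℕ → Set
Ordered (i , j) = ℕ.NonZero i × i ℕ.< j

-- This keeps all denominators nonzero and all indices positive, away from the default values of
-- `frac` and `kAt`.
pairs-ordered : ∀ m → All Ordered (pairs m)
pairs-ordered m = All.concat⁺ (All.map⁺ (All.universal column (oneTo m)))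
  where
  column : ∀ j → All Ordered (map (λ i → i , j) (oneTo (j ∸ 1)))
  column zero    = []
  column (suc j) = All.map⁺ (All.map⁺ (All.applyUpTo⁺₁ (λ i → i) j (λ i<j → _ , s≤s i<j)))

∏-kAt : ∀ {m} (g : ℤ → ℤ) (k : Vec ℤ m) → ∏ℤ (g ∘ kAt k) (oneTo m) ≡ ∏ℤ g (Vec.toList k)
∏-kAt g []      = refl
∏-kAt {suc m} g (x ∷ k) = trans (∏-oneTo-first (g ∘ kAt (x ∷ k)) m) (cong (g x *_)
  (trans (∏ℤ-cong-All (λ { (suc i) _ → cong g (kAt-suc x k i) }) (oneTo-positive m)) (∏-kAt g k)))

∏-pairs-kAt : ∀ {m} (h : ℤ → ℤ → ℤ) (k : Vec ℤ m) →
  ∏ℤ (λ p → h (kAt k (proj₁ p)) (kAt k (proj₂ p))) (pairs m) ≡ pairProduct h (Vec.toList k)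
∏-pairs-kAt h []      = refl
∏-pairs-kAt {suc m} h (x ∷ k) = trans (∏-pairs-first (λ p → h (kAt (x ∷ k) (proj₁ p)) (kAt (x ∷ k) (proj₂ p))) m)
  (cong₂ _*_
    (trans (∏ℤ-cong-All (λ { (suc j) _ → cong (h x) (kAt-suc x k j) }) (oneTo-positive m)) (∏-kAt (h x) k))
    (trans (∏ℤ-cong-All (λ { (suc i , suc j) _ → cong₂ h (kAt-suc x k i) (kAt-suc x k j) }) (pairs-ordered m)) (∏-pairs-kAt h k)))

∏ℤ-scale : ∀ c (f : ℤ → ℤ) xs → ∏ℤ (λ x → + c * f x) xs ≡ + (c ℕ.^ length xs) * ∏ℤ f xs
∏ℤ-scale c f []       = refl
∏ℤ-scale c f (x ∷ xs) = begin
  + c * f x * ∏ℤ (λ x → + c * f x) xs              ≡⟨ cong (+ c * f x *_) (∏ℤ-scale c f xs) ⟩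
  + c * f x * (+ (c ℕ.^ length xs) * ∏ℤ f xs)      ≡⟨ lem (+ c) (f x) (+ (c ℕ.^ length xs)) (∏ℤ f xs) ⟩
  + c * + (c ℕ.^ length xs) * (f x * ∏ℤ f xs)      ≡⟨ cong (_* (f x * ∏ℤ f xs)) (ℤ.pos-* c (c ℕ.^ length xs)) ⟨
  + (c ℕ.^ suc (length xs)) * (f x * ∏ℤ f xs)      ∎
  where
  open ≡-Reasoning
  lem : ∀ a b c d → a * b * (c * d) ≡ a * c * (b * d)
  lem = solve-∀

[1+n]C2 : ∀ n → suc n C 2 ≡ n ℕ.+ n C 2
[1+n]C2 n = trans (sym (nCk+nC[k+1]≡[n+1]C[k+1] n 1)) (cong (ℕ._+ n C 2) (nC1≡n n))

module _ (b : ℤ) where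

  num : ℤ → ℤ → ℤ
  num x y = (y - x) * (+ 2 * b + + 1 - x - y)

  private
    w : ℤ → ℤ
    w x = - (τ b x * τ b x)

  vandermonde-num : ∀ xs → vandermonde w xs ≡ + (4 ℕ.^ (length xs C 2)) * pairProduct num xs
  vandermonde-num []       = refl
  vandermonde-num (x ∷ xs) = begin
    ∏ℤ (λ y → w y - w x) xs * vandermonde w xs
      ≡⟨ cong₂ _*_ (trans (∏ℤ-cong (λ y → lem b x y) xs) (∏ℤ-scale 4 (num x) xs)) (vandermonde-num xs) ⟩
    + (4 ℕ.^ n) * ∏ℤ (num x) xs * (+ (4 ℕ.^ (n C 2)) * pairProduct num xs)
      ≡⟨ lem₂ (+ (4 ℕ.^ n)) (∏ℤ (num x) xs) (+ (4 ℕ.^ (n C 2))) (pairProduct num xs) ⟩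
    + (4 ℕ.^ n) * + (4 ℕ.^ (n C 2)) * (∏ℤ (num x) xs * pairProduct num xs)
      ≡⟨ cong (_* (∏ℤ (num x) xs * pairProduct num xs)) power ⟩
    + (4 ℕ.^ (suc n C 2)) * (∏ℤ (num x) xs * pairProduct num xs) ∎
    where
    open ≡-Reasoning
    n = length xs
    lem : ∀ b x y → - ((+ 2 * b + + 1 - + 2 * y) * (+ 2 * b + + 1 - + 2 * y)) - - ((+ 2 * b + + 1 - + 2 * x) * (+ 2 * b + + 1 - + 2 * x))
      ≡ + 4 * ((y - x) * (+ 2 * b + + 1 - x - y))
    lem = solve-∀
    lem₂ : ∀ a b c d → a * b * (c * d) ≡ a * c * (b * d)
    lem₂ = solve-∀
    power : + (4 ℕ.^ n) * + (4 ℕ.^ (n C 2)) ≡ + (4 ℕ.^ (suc n C 2))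
    power = begin
      + (4 ℕ.^ n) * + (4 ℕ.^ (n C 2))  ≡⟨ ℤ.pos-* (4 ℕ.^ n) (4 ℕ.^ (n C 2)) ⟨
      + (4 ℕ.^ n ℕ.* 4 ℕ.^ (n C 2))    ≡⟨ cong +_ (ℕ.^-distribˡ-+-* 4 n (n C 2)) ⟨
      + (4 ℕ.^ (n ℕ.+ n C 2))          ≡⟨ cong (λ u → + (4 ℕ.^ u)) ([1+n]C2 n) ⟨
      + (4 ℕ.^ (suc n C 2))            ∎

  -- The first row supplies the factor in front: 1 for `E`, and τ for `O`, which is the origin of
  -- the linear factors for even order.
  det-family : ∀ e xs → det (family b e) 0 (length xs) xs
    ≡ ∏ℤ (family b e 0) xs * (+ (4 ℕ.^ (length xs C 2)) * pairProduct num xs)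
  det-family e xs = trans (eval e xs) (cong (∏ℤ (family b e 0) xs *_) (vandermonde-num xs))
    where
    α γ : Bool → ℕ → ℤ
    -- The values of `α` at 0 belong to the initial relations `E 1` = w and `O 1` = (w - 2) τ.
    α true  zero    = + 0
    α true  (suc i) = - ((+ 2 * + i + + 2) * (+ 2 * + i + + 1)) - (+ 2 * + i + + 3) * (+ 2 * + i + + 2)
    α false zero    = - + 2
    α false (suc i) = - ((+ 2 * + i + + 3) * (+ 2 * + i + + 2)) - (+ 2 * + i + + 4) * (+ 2 * + i + + 3)
    γ true  i = - ((+ 2 * + i + + 2) * (+ 2 * + i + + 1) * (+ 2 * + i + + 1) * (+ 2 * + i))
    γ false i = - ((+ 2 * + i + + 3) * (+ 2 * + i + + 2) * (+ 2 * + i + + 2) * (+ 2 * + i + + 1))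
    E₁ : ∀ τ → - (τ * τ) - + 0 ≡ (- (τ * τ) + + 0) * + 1
    E₁ = solve-∀
    O₁ : ∀ τ → τ * (- (τ * τ) - + 0) - + 2 * τ ≡ (- (τ * τ) + - + 2) * τ
    O₁ = solve-∀
    eval : ∀ e xs → det (family b e) 0 (length xs) xs ≡ ∏ℤ (family b e 0) xs * vandermonde w xs
    eval true  = ThreeTerm.det≡vandermonde (family b true) w (α true) (γ true)
      (λ x → E₁ (τ b x)) (λ i x → E-three-term i (τ b x))
    eval false = ThreeTerm.det≡vandermonde (family b false) w (α false) (γ false)
      (λ x → O₁ (τ b x)) (λ i x → O-three-term i (τ b x))

-- Clearing denominators in the rationals

ι : ℤ → ℚ
ι z = z ℚ./ 1

fromℚᵘ-* : ∀ p q → ℚ.fromℚᵘ (p ℚᵘ.* q) ≡ ℚ.fromℚᵘ p ℚ.* ℚ.fromℚᵘ q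
fromℚᵘ-* p q = ℚ.toℚᵘ-injective (begin
  ℚ.toℚᵘ (ℚ.fromℚᵘ (p ℚᵘ.* q))                            ≈⟨ ℚ.toℚᵘ-fromℚᵘ (p ℚᵘ.* q) ⟩
  p ℚᵘ.* q                                                ≈⟨ ℚᵘ.*-cong (ℚ.toℚᵘ-fromℚᵘ p) (ℚ.toℚᵘ-fromℚᵘ q) ⟨
  ℚ.toℚᵘ (ℚ.fromℚᵘ p) ℚᵘ.* ℚ.toℚᵘ (ℚ.fromℚᵘ q)            ≈⟨ ℚ.toℚᵘ-homo-* (ℚ.fromℚᵘ p) (ℚ.fromℚᵘ q) ⟨
  ℚ.toℚᵘ (ℚ.fromℚᵘ p ℚ.* ℚ.fromℚᵘ q)                      ∎)
  where open SetoidReasoning ℚᵘ.≃-setoid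

ι-* : ∀ x y → ι (x * y) ≡ ι x ℚ.* ι y
ι-* x y = fromℚᵘ-* (mkℚᵘ x 0) (mkℚᵘ y 0)

frac-cancel : ∀ p d .{{_ : ℕ.NonZero d}} → frac p d ℚ.* ι (+ d) ≡ ι p
frac-cancel p (suc d) = trans (sym (fromℚᵘ-* (mkℚᵘ p d) (mkℚᵘ (+ suc d) 0)))
  (ℚ.fromℚᵘ-cong {mkℚᵘ p d ℚᵘ.* mkℚᵘ (+ suc d) 0} {mkℚᵘ p 0} (*≡* lem))
  where
  lem : p * + suc d * + 1 ≡ p * + suc (d ℕ.* 1)
  lem = trans (ℤ.*-identityʳ (p * + suc d)) (cong (λ u → p * + suc u) (sym (ℕ.*-identityʳ d)))

ι-cancelʳ : ∀ {z} → Positive z → ∀ p q → p ℚ.* ι z ≡ q ℚ.* ι z → p ≡ q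
ι-cancelʳ (d , refl) p q eq = trans (sym (undo p)) (trans (cong (ℚ._* frac (+ 1) (suc d)) eq) (undo q))
  where
  undo : ∀ r → r ℚ.* ι (+ suc d) ℚ.* frac (+ 1) (suc d) ≡ r
  undo r = trans (ℚ.*-assoc r (ι (+ suc d)) (frac (+ 1) (suc d)))
    (trans (cong (r ℚ.*_) (trans (ℚ.*-comm (ι (+ suc d)) (frac (+ 1) (suc d))) (frac-cancel (+ 1) (suc d))))
           (ℚ.*-identityʳ r))

ℚ-interchange : ∀ a b c d → (a ℚ.* b) ℚ.* (c ℚ.* d) ≡ (a ℚ.* c) ℚ.* (b ℚ.* d)
ℚ-interchange a b c d = begin
  (a ℚ.* b) ℚ.* (c ℚ.* d)  ≡⟨ ℚ.*-assoc a b (c ℚ.* d) ⟩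
  a ℚ.* (b ℚ.* (c ℚ.* d))  ≡⟨ cong (a ℚ.*_) (ℚ.*-assoc b c d) ⟨
  a ℚ.* (b ℚ.* c ℚ.* d)    ≡⟨ cong (λ u → a ℚ.* (u ℚ.* d)) (ℚ.*-comm b c) ⟩
  a ℚ.* (c ℚ.* b ℚ.* d)    ≡⟨ cong (a ℚ.*_) (ℚ.*-assoc c b d) ⟩
  a ℚ.* (c ℚ.* (b ℚ.* d))  ≡⟨ ℚ.*-assoc a c (b ℚ.* d) ⟨
  (a ℚ.* c) ℚ.* (b ℚ.* d)  ∎
  where open ≡-Reasoning

prodℚ-cancel : ∀ {A : Set} {V : A → Set} (f : A → ℚ) (n d : A → ℤ) →
  (∀ x → V x → f x ℚ.* ι (d x) ≡ ι (n x)) → ∀ {xs} → All V xs →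
  prodℚ (map f xs) ℚ.* ι (∏ℤ d xs) ≡ ι (∏ℤ n xs)
prodℚ-cancel f n d eq []              = refl
prodℚ-cancel f n d eq {x ∷ xs} (v ∷ vs) = begin
  f x ℚ.* prodℚ (map f xs) ℚ.* ι (d x * ∏ℤ d xs)             ≡⟨ cong (f x ℚ.* prodℚ (map f xs) ℚ.*_) (ι-* (d x) (∏ℤ d xs)) ⟩
  f x ℚ.* prodℚ (map f xs) ℚ.* (ι (d x) ℚ.* ι (∏ℤ d xs))     ≡⟨ ℚ-interchange (f x) (prodℚ (map f xs)) (ι (d x)) (ι (∏ℤ d xs)) ⟩
  f x ℚ.* ι (d x) ℚ.* (prodℚ (map f xs) ℚ.* ι (∏ℤ d xs))     ≡⟨ cong₂ ℚ._*_ (eq x v) (prodℚ-cancel f n d eq vs) ⟩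
  ι (n x) ℚ.* ι (∏ℤ n xs)                                    ≡⟨ ι-* (n x) (∏ℤ n xs) ⟨
  ι (n x * ∏ℤ n xs)                                          ∎
  where open ≡-Reasoning

*-nonZero : ∀ m n → ℕ.NonZero m → ℕ.NonZero n → ℕ.NonZero (m ℕ.* n)
*-nonZero m n p q = ℕ.m*n≢0 m n {{p}} {{q}}

module _ {m : ℕ} (b : ℤ) (k : Vec ℤ m) where

  private
    ks = Vec.toList k
    four = + (4 ℕ.^ (m C 2))

  -- The product of the denominators is the integer that multiplies the generating function in
  -- `weight-sum`, so the two can be compared after clearing it.
  rhsOdd-cancel : rhsOdd m b k ℚ.* ι (∏ₙ (factorials true) 0 m) ≡ ι (four * pairProduct (num b) ks)
  rhsOdd-cancel = begin
    ι four ℚ.* R ℚ.* ι (∏ₙ (factorials true) 0 m)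
      ≡⟨ ℚ.*-assoc (ι four) R (ι (∏ₙ (factorials true) 0 m)) ⟩
    ι four ℚ.* (R ℚ.* ι (∏ₙ (factorials true) 0 m))
      ≡⟨ cong (λ u → ι four ℚ.* (R ℚ.* ι u)) (∏-oddDen m) ⟨
    ι four ℚ.* (R ℚ.* ι (∏ℤ oddDen (pairs m)))
      ≡⟨ cong (ι four ℚ.*_) (prodℚ-cancel _ (λ p → num b (kAt k (proj₁ p)) (kAt k (proj₂ p))) oddDen cancel (pairs-ordered m)) ⟩
    ι four ℚ.* ι (∏ℤ (λ p → num b (kAt k (proj₁ p)) (kAt k (proj₂ p))) (pairs m))
      ≡⟨ cong (λ u → ι four ℚ.* ι u) (∏-pairs-kAt (num b) k) ⟩
    ι four ℚ.* ι (pairProduct (num b) ks)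
      ≡⟨ ι-* four (pairProduct (num b) ks) ⟨
    ι (four * pairProduct (num b) ks) ∎
    where
    open ≡-Reasoning
    f : ℕ × ℕ → ℚ
    f = λ { (i , j) → frac (pairNum b k i j) ((j ∸ i) ℕ.* (i ℕ.+ j ∸ 1)) }
    R = prodℚ (map f (pairs m))
    cancel : ∀ p → Ordered p → f p ℚ.* ι (oddDen p) ≡ ι (num b (kAt k (proj₁ p)) (kAt k (proj₂ p)))
    cancel (suc i , j) (_ , i<j) = frac-cancel (pairNum b k (suc i) j) ((j ∸ suc i) ℕ.* (i ℕ.+ j))
      {{*-nonZero (j ∸ suc i) (i ℕ.+ j) (ℕ.>-nonZero (ℕ.m<n⇒0<n∸m i<j))
          (ℕ.>-nonZero (ℕ.<-≤-trans (ℕ.<-≤-trans (s≤s z≤n) i<j) (ℕ.m≤n+m j i)))}}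

  rhsEven-cancel : rhsEven m b k ℚ.* ι (∏ₙ (factorials false) 0 m) ≡ ι (four * pairProduct (num b) ks * ∏ℤ (τ b) ks)
  rhsEven-cancel = begin
    ι four ℚ.* R ℚ.* R′ ℚ.* ι (∏ₙ (factorials false) 0 m)
      ≡⟨ cong (λ u → ι four ℚ.* R ℚ.* R′ ℚ.* ι u) (∏-evenDen m) ⟨
    ι four ℚ.* R ℚ.* R′ ℚ.* ι (D * D′)
      ≡⟨ cong (ι four ℚ.* R ℚ.* R′ ℚ.*_) (ι-* D D′) ⟩
    ι four ℚ.* R ℚ.* R′ ℚ.* (ι D ℚ.* ι D′)
      ≡⟨ ℚ-interchange (ι four ℚ.* R) R′ (ι D) (ι D′) ⟩
    ι four ℚ.* R ℚ.* ι D ℚ.* (R′ ℚ.* ι D′)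
      ≡⟨ cong (ℚ._* (R′ ℚ.* ι D′)) (ℚ.*-assoc (ι four) R (ι D)) ⟩
    ι four ℚ.* (R ℚ.* ι D) ℚ.* (R′ ℚ.* ι D′)
      ≡⟨ cong₂ (λ u v → ι four ℚ.* u ℚ.* v)
           (trans (prodℚ-cancel f (λ p → num b (kAt k (proj₁ p)) (kAt k (proj₂ p))) evenDen cancel (pairs-ordered m))
                  (cong ι (∏-pairs-kAt (num b) k)))
           (trans (prodℚ-cancel f′ (τ b ∘ kAt k) +_ (λ i i≢0 → frac-cancel (τ b (kAt k i)) i {{i≢0}}) (oneTo-positive m))
                  (cong ι (∏-kAt (τ b) k))) ⟩
    ι four ℚ.* ι (pairProduct (num b) ks) ℚ.* ι (∏ℤ (τ b) ks)
      ≡⟨ cong (ℚ._* ι (∏ℤ (τ b) ks)) (ι-* four (pairProduct (num b) ks)) ⟨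
    ι (four * pairProduct (num b) ks) ℚ.* ι (∏ℤ (τ b) ks)
      ≡⟨ ι-* (four * pairProduct (num b) ks) (∏ℤ (τ b) ks) ⟨
    ι (four * pairProduct (num b) ks * ∏ℤ (τ b) ks) ∎
    where
    open ≡-Reasoning
    f : ℕ × ℕ → ℚ
    f = λ { (i , j) → frac (pairNum b k i j) ((j ∸ i) ℕ.* (i ℕ.+ j)) }
    f′ : ℕ → ℚ
    f′ i = frac (τ b (kAt k i)) i
    R  = prodℚ (map f (pairs m))
    R′ = prodℚ (map f′ (oneTo m))
    D  = ∏ℤ evenDen (pairs m)
    D′ = ∏ℤ +_ (oneTo m)
    cancel : ∀ p → Ordered p → f p ℚ.* ι (evenDen p) ≡ ι (num b (kAt k (proj₁ p)) (kAt k (proj₂ p)))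
    cancel (suc i , j) (_ , i<j) = frac-cancel (pairNum b k (suc i) j) ((j ∸ suc i) ℕ.* (suc i ℕ.+ j))
      {{*-nonZero (j ∸ suc i) (suc i ℕ.+ j) (ℕ.>-nonZero (ℕ.m<n⇒0<n∸m i<j)) _}}

-- Parity of the order and comparison with the product formulas

toList-WeaklyIncreasing : ∀ {b m} (k : Vec ℤ (suc m)) →
  (∀ (i j : Fin (suc m)) → i Fin.< j → lookup k i ℤ.< lookup k j) →
  (∀ (i : Fin (suc m)) → lookup k i ℤ.≤ b) → WeaklyIncreasing b (Vec.toList k)
toList-WeaklyIncreasing (x ∷ [])    inc bnd = last (bnd Fin.zero)
toList-WeaklyIncreasing (x ∷ y ∷ k) inc bnd =
  ℤ.<⇒≤ (inc Fin.zero (Fin.suc Fin.zero) (s≤s z≤n))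
    ∷ toList-WeaklyIncreasing (y ∷ k) (λ i j i<j → inc (Fin.suc i) (Fin.suc j) (s≤s i<j)) (bnd ∘ Fin.suc)

suc-%2 : ∀ n → suc n % 2 ≡ (if even n then 1 else 0)
suc-%2 zero          = refl
suc-%2 (suc zero)    = refl
suc-%2 (suc (suc n)) with even n | suc-%2 n
... | true  | eq = eq
... | false | eq = eq

odd⇒even-pred : ∀ n → suc n % 2 ≡ 1 → even n ≡ true
odd⇒even-pred n eq with even n | suc-%2 n
... | true  | _  = refl
... | false | eq′ = contradiction (trans (sym eq) eq′) λ ()

even⇒odd-pred : ∀ n → suc n % 2 ≡ 0 → even n ≡ false
even⇒odd-pred n eq with even n | suc-%2 n
... | false | _  = refl
... | true  | eq′ = contradiction (trans (sym eq) eq′) λ ()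

∏ℤ-one : ∀ {A : Set} (xs : List A) → ∏ℤ (λ _ → + 1) xs ≡ + 1
∏ℤ-one []       = refl
∏ℤ-one (x ∷ xs) = trans (ℤ.*-identityˡ _) (∏ℤ-one xs)

module _ (b : ℤ) (n : ℕ) (k : Vec ℤ ⌈ suc n /2⌉) (inc : WeaklyIncreasing b (Vec.toList k)) where

  private
    m = ⌈ suc n /2⌉
    ks = Vec.toList k
    S = sumℕ (map weight (triangles b n ks))

  weight-sum : + S * ∏ₙ (factorials (even n)) 0 m
    ≡ ∏ℤ (family b (even n) 0) ks * (+ (4 ℕ.^ (m C 2)) * pairProduct (num b) ks)
  weight-sum = begin
    + S * ∏ₙ (factorials (even n)) 0 m
      ≡⟨ cong₂ _*_ (sumℕ-∑ weight (triangles b n ks)) (sym (scale-factorials n)) ⟩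
    total b n ks * scale n
      ≡⟨ ℤ.*-comm (total b n ks) (scale n) ⟩
    scale n * total b n ks
      ≡⟨ total-det b n ks (length-toList k) inc ⟩
    det (family b (even n)) 0 (length ks) ks
      ≡⟨ det-family b (even n) ks ⟩
    ∏ℤ (family b (even n) 0) ks * (+ (4 ℕ.^ (length ks C 2)) * pairProduct (num b) ks)
      ≡⟨ cong (λ l → ∏ℤ (family b (even n) 0) ks * (+ (4 ℕ.^ (l C 2)) * pairProduct (num b) ks)) (length-toList k) ⟩
    ∏ℤ (family b (even n) 0) ks * (+ (4 ℕ.^ (m C 2)) * pairProduct (num b) ks) ∎
    where open ≡-Reasoning

  weight-sum-odd : suc n % 2 ≡ 1 → ι (+ S) ≡ rhsOdd m b k
  weight-sum-odd odd with even n | odd⇒even-pred n odd | weight-sum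
  ... | true | _ | eq = ι-cancelʳ (∏ₙ-positive (factorials-positive true) 0 m) (ι (+ S)) (rhsOdd m b k) (begin
    ι (+ S) ℚ.* ι Z
      ≡⟨ ι-* (+ S) Z ⟨
    ι (+ S * Z)
      ≡⟨ cong ι (trans eq (trans (cong (_* N) (∏ℤ-one ks)) (ℤ.*-identityˡ N))) ⟩
    ι N
      ≡⟨ rhsOdd-cancel b k ⟨
    rhsOdd m b k ℚ.* ι Z ∎)
    where
    open ≡-Reasoning
    Z = ∏ₙ (factorials true) 0 m
    N = + (4 ℕ.^ (m C 2)) * pairProduct (num b) ks

  weight-sum-even : suc n % 2 ≡ 0 → ι (+ S) ≡ rhsEven m b k
  weight-sum-even ev with even n | even⇒odd-pred n ev | weight-sum
  ... | false | _ | eq = ι-cancelʳ (∏ₙ-positive (factorials-positive false) 0 m) (ι (+ S)) (rhsEven m b k) (begin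
    ι (+ S) ℚ.* ι Z
      ≡⟨ ι-* (+ S) Z ⟨
    ι (+ S * Z)
      ≡⟨ cong ι (trans eq (ℤ.*-comm (∏ℤ (τ b) ks) N)) ⟩
    ι (N * ∏ℤ (τ b) ks)
      ≡⟨ rhsEven-cancel b k ⟨
    rhsEven m b k ℚ.* ι Z ∎)
    where
    open ≡-Reasoning
    Z = ∏ₙ (factorials false) 0 m
    N = + (4 ℕ.^ (m C 2)) * pairProduct (num b) ks

theoremA1 : (n : ℕ) → 1 ≤ n → (b : ℤ) → (k : Vec ℤ ⌈ n /2⌉) →
    (∀ (i j : Fin ⌈ n /2⌉) → i Fin.< j → lookup k i ℤ.< lookup k j) →
    (∀ (i : Fin ⌈ n /2⌉) → lookup k i ℤ.≤ b) →
    Σ (List Triangle) λ L →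
    Unique L ×
    (∀ T → (T ∈ L) ⇔ (IsHMT n T × BottomRow n T (Vec.toList k) × BoundedBy b T)) ×
    (n % 2 ≡ 1 → (+ sumℕ (map weight L) ℚ./ 1) ≡ rhsOdd ⌈ n /2⌉ b k) ×
    (n % 2 ≡ 0 → (+ sumℕ (map weight L) ℚ./ 1) ≡ rhsEven ⌈ n /2⌉ b k)
theoremA1 (suc n) _ b k inc bnd =
  triangles b n (Vec.toList k) ,
  triangles-unique b n (Vec.toList k) ,
  (λ T → mk⇔ (triangles-sound b n (Vec.toList k) (length-toList k) weak) (triangles-complete b n (Vec.toList k))) ,
  weight-sum-odd b n k weak ,
  weight-sum-even b n k weak
  where
  weak : WeaklyIncreasing b (Vec.toList k)
  weak = toList-WeaklyIncreasing k inc bnd
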